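{- Let $m$ be an odd integer with $m \geqslant 5$. Then the complete symmetric digraph $K^*_{2m}$ admits a $\vec{C}_m$-factorization, i.e. a resolvable decomposition into directed cycles of length $m$.
   Context: $K^*_n$ denotes the complete symmetric digraph on $n$ vertices: the strict digraph in which for any two distinct vertices $x,y$ both arcs $(x,y)$ and $(y,x)$ are present. $\vec{C}_m$ denotes the directed cycle of length $m$. A decomposition of a digraph $G$ is a set of subdigraphs whose arc sets partition $A(G)$. A $\vec{C}_m$-factor of $G$ is a spanning subdigraph of $G$ that is a disjoint union of directed cycles of length $m$; a $\vec{C}_m$-factorization of $G$ is a decomposition of $G$ into $\vec{C}_m$-factors. -}

module Defs where

open import Data.Nat using (ℕ; suc)
open import Data.Nat.DivMod using (_%_; m%n<n)
open import Data.Fin using (Fin; toℕ; fromℕ<)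
open import Data.Product using (Σ; Σ-syntax; _×_)
open import Relation.Binary.PropositionalEquality using (_≡_; _≢_; subst)
open import Function.Definitions using (Injective)

next : ∀ {m} → Fin m → Fin m
next {suc k} i = fromℕ< (m%n<n (suc (toℕ i)) (suc k))

-- A directed cycle of length m in K*_n (vertex set Fin n):
-- m distinct vertices v₀ … v_{m-1}, with arcs (vᵢ , v_{i+1 mod m}).
-- (For m ≥ 2 consecutive vertices are distinct, so all arcs are arcs of K*_n.)
record DiCycle (m n : ℕ) : Set where
  field
    vert : Fin m → Fin n
    inj  : Injective _≡_ _≡_ vert
open DiCycle public

ArcAt : ∀ {m n} → DiCycle m n → Fin m → Fin n → Fin n → Set
ArcAt C i x y = (vert C i ≡ x) × (vert C (next i) ≡ y)

record CmFactor (m n : ℕ) : Set where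
  field
    t     : ℕ
    cyc   : Fin t → DiCycle m n
    cover : ∀ (v : Fin n) → Σ[ j ∈ Fin t ] Σ[ i ∈ Fin m ] vert (cyc j) i ≡ v
    disj  : ∀ (v : Fin n) (j j′ : Fin t) (i i′ : Fin m) →
            vert (cyc j) i ≡ v → vert (cyc j′) i′ ≡ v → (j ≡ j′) × (i ≡ i′)
open CmFactor public

record CmFactorization (m n : ℕ) : Set where
  field
    k       : ℕ
    factor  : Fin k → CmFactor m n
    covered : ∀ (x y : Fin n) → x ≢ y →
              Σ[ f ∈ Fin k ] Σ[ j ∈ Fin (t (factor f)) ] Σ[ i ∈ Fin m ]
                ArcAt (cyc (factor f) j) i x y
    unique  : ∀ (x y : Fin n) (f f′ : Fin k)
              (j : Fin (t (factor f))) (j′ : Fin (t (factor f′))) (i i′ : Fin m) →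
              ArcAt (cyc (factor f) j) i x y → ArcAt (cyc (factor f′) j′) i′ x y →
              Σ[ e ∈ f ≡ f′ ] (subst (λ g → Fin (t (factor g))) e j ≡ j′) × (i ≡ i′)

{-# OPTIONS --safe #-}

-- Write m = 2h + 1. Walecki's zigzags H₀, …, H_{h−1} decompose the complete graph on ℤ_{2h} ∪ {∞} into Hamiltonian
-- cycles; blow every vertex up into two levels. A proper 3-colouring of Hᵢ yields four transversals of the levels
-- that meet every pair of consecutive vertices of Hᵢ in the four possible ways. Running along Hᵢ on such a
-- transversal and backwards along Hᵢ on its complement gives four factors using exactly the arcs above Hᵢ.
-- This leaves the arcs between the two levels of a vertex. They are absorbed by replacing the eight factors above
-- H₀ and H₁ by nine. Along H₀ the union of H₀ and H₁ is a strip of bounded width, so these nine factors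
-- can be chosen periodic along the strip; a factor is then certified by a table that gives, for every vertex,
-- its successor and its index on its cycle as an affine function of the length of the strip and the place in it.
-- The tables were found by computer search, separately for even and odd h ≥ 6; for 2 ≤ h ≤ 5 the cycles are listed.
module Submission where

open import Defs
open import Data.Nat using (ℕ; zero; suc; _+_; _*_; _∸_; _≤_; _<_; _≤?_; z≤n; s≤s; s≤s⁻¹)
open import Data.Nat.Divisibility using (_∣_; divides)
open import Data.Nat.DivMod using (_%_; m%n<n; m<n⇒m%n≡m; n%n≡0; %-distribˡ-+; m%n%n≡m%n)
import Data.Nat.Properties as ℕₚ
open import Data.Nat.Tactic.RingSolver using (solve-∀)
open import Data.Fin using (Fin; zero; suc; toℕ; fromℕ; fromℕ<; combine; remQuot; splitAt; punchIn; punchOut; opposite;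
  inject₁; _↑ˡ_; _↑ʳ_; _≟_)
open import Data.Fin.Patterns
import Data.Fin.Properties as Finₚ
open import Data.Empty using (⊥-elim)
open import Data.Product using (Σ-syntax; ∃; ∃₂; _×_; _,_; proj₁; proj₂; uncurry)
open import Data.Product.Properties using (≡-dec)
open import Data.Sum using (_⊎_; inj₁; inj₂; map)
open import Data.Vec using (Vec; lookup; _∷_; [])
open import Function using (_∘_)
open import Function.Definitions using (Injective)
open import Relation.Nullary using (¬_; Dec; yes; no; contradiction; recompute)
open import Relation.Nullary.Decidable using (from-yes; _→-dec_; _×-dec_; _⊎-dec_; ¬?)
open import Relation.Binary using (tri<; tri≈; tri>)
open import Relation.Binary.PropositionalEquality

-- Four factors above each zigzag give 4h, one short of the 2m - 1 = 4h + 1 that are wanted. The 2m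
-- arcs between the levels would be just enough for one more, but they close up in pairs to cycles
-- of length 2, so they must be spread over several factors, and a cycle that uses one meets both
-- copies of a vertex and is no longer a transversal. H₁ is H₀ with the finite labels raised by one
-- modulo 2h. This moves odd positions of the zigzag two places on and even ones two places back;
-- hence, away from the ends, a step of H₁ goes 5 places forward or 3 back along H₀. This is the
-- bounded width. That a periodic successor rule closes up to two cycles of length m for every
-- length of the strip is a global fact. An index that grows by one along each arc makes it local,
-- so that finitely many comparisons of affine forms decide it for all lengths at once. Disjointness
-- is always obtained by counting: a map onto a set of the same size is injective. This serves the
-- vertices of a factor, the states on the cycles and the arcs of the factorization.

injective⇒surjective : ∀ {n} {f : Fin n → Fin n} → Injective _≡_ _≡_ f → ∀ y → ∃ λ x → f x ≡ y
injective⇒surjective {suc n} {f} inj y with Finₚ.any? (λ x → f x ≟ y)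
... | yes p = p
... | no ¬p = ⊥-elim (Finₚ.<⇒notInjective {f = λ x → punchOut (y≢f x)} ℕₚ.≤-refl
                   λ eq → inj (Finₚ.punchOut-injective (y≢f _) (y≢f _) eq))
  where
  y≢f : ∀ x → y ≢ f x
  y≢f x eq = ¬p (x , sym eq)

-- A section `g` of `f` is injective, hence onto; every argument of `f` is then a value of `g`, and
-- `f` undoes `g`.
surjective⇒injective : ∀ {n} {f : Fin n → Fin n} → (∀ y → ∃ λ x → f x ≡ y) → Injective _≡_ _≡_ f
surjective⇒injective {f = f} surj {x} {x′} fx≡fx′ =
  let y , gy≡x    = injective⇒surjective g-injective x
      y′ , gy′≡x′ = injective⇒surjective g-injective x′
      y≡y′ = begin
        y          ≡⟨ f∘g y ⟨
        f (g y)    ≡⟨ cong f gy≡x ⟩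
        f x        ≡⟨ fx≡fx′ ⟩
        f x′       ≡⟨ cong f gy′≡x′ ⟨
        f (g y′)   ≡⟨ f∘g y′ ⟩
        y′         ∎
  in trans (sym gy≡x) (trans (cong g y≡y′) gy′≡x′)
  where
  open ≡-Reasoning

  g : _ → _
  g = proj₁ ∘ surj

  f∘g : ∀ y → f (g y) ≡ y
  f∘g = proj₂ ∘ surj

  g-injective : Injective _≡_ _≡_ g
  g-injective {y} {y′} eq = trans (sym (f∘g y)) (trans (cong f eq) (f∘g y′))

-- Factors with two cycles, and the counting that yields disjointness

record Factor (m : ℕ) : Set where
  field
    at   : Fin 2 → Fin m → Fin (2 * m)
    onto : ∀ v → ∃₂ λ j i → at j i ≡ v
open Factor

Arc : ∀ {m} → Factor m → Fin (2 * m) → Fin (2 * m) → Set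
Arc F x y = ∃₂ λ j i → at F j i ≡ x × at F j (next i) ≡ y

-- The two cycles have `2 * m` slots for `2 * m` vertices, so `onto` already forces different slots
-- to carry different vertices. This is why `Factor` has no field for injectivity.
at-injective : ∀ {m} (F : Factor m) {j j′ i i′} → at F j i ≡ at F j′ i′ → j ≡ j′ × i ≡ i′
at-injective {m} F {j} {j′} {i} {i′} eq =
  Finₚ.combine-injective j i j′ i′ (surjective⇒injective surj
    (trans (flat-combine j i) (trans eq (sym (flat-combine j′ i′)))))
  where
  flat : Fin (2 * m) → Fin (2 * m)
  flat = uncurry (at F) ∘ remQuot m

  flat-combine : ∀ j i → flat (combine j i) ≡ at F j i
  flat-combine j i = cong (uncurry (at F)) (Finₚ.remQuot-combine j i)

  surj : ∀ v → ∃ λ x → flat x ≡ v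
  surj v = let j , i , eq = onto F v in combine j i , trans (flat-combine j i) eq

toCmFactor : ∀ {m} → Factor m → CmFactor m (2 * m)
toCmFactor F = record
  { t     = 2
  ; cyc   = λ j → record { vert = at F j ; inj = proj₂ ∘ at-injective F }
  ; cover = onto F
  ; disj  = λ v j j′ i i′ p q → at-injective F (trans p (sym q))
  }

-- Choosing for each of the `k` elements other than `x` an index related to it gives a map `s`
-- between sets of size `k`. As `R` is functional, `s` is injective and so onto: every index is the
-- chosen one of some element, and two indices of the same `y` come from the same choice.
unique-index : ∀ {k N} → suc k ≡ N → (R : Fin k → Fin N → Set) →
               (∀ {f y y′} → R f y → R f y′ → y ≡ y′) →
               ∀ x → (∀ y → x ≢ y → ∃ λ f → R f y) →
               ∀ {y f f′} → R f y → R f′ y → f ≡ f′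
unique-index refl R functional x cov {y} {f} {f′} r r′ =
  let z , sz≡f    = injective⇒surjective s-injective f
      z′ , sz′≡f′ = injective⇒surjective s-injective f′
      z≡z′ = Finₚ.punchIn-injective x z z′
        (trans (agree sz≡f (s-arc z) r)
               (sym (agree sz′≡f′ (s-arc z′) r′)))
  in trans (sym sz≡f) (trans (cong s z≡z′) sz′≡f′)
  where
  agree : ∀ {f f′ y y′} → f ≡ f′ → R f y → R f′ y′ → y ≡ y′
  agree refl = functional

  arc : ∀ z → ∃ λ f → R f (punchIn x z)
  arc z = cov (punchIn x z) (Finₚ.punchInᵢ≢i x z ∘ sym)

  s : _ → _
  s = proj₁ ∘ arc

  s-arc : ∀ z → R (s z) (punchIn x z)
  s-arc = proj₂ ∘ arc

  s-injective : Injective _≡_ _≡_ s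
  s-injective {z} {z′} eq =
    Finₚ.punchIn-injective x z z′ (agree eq (s-arc z) (s-arc z′))

Arc-functional : ∀ {m} (F : Factor m) {x y y′} → Arc F x y → Arc F x y′ → y ≡ y′
Arc-functional F (j , i , p , q) (j′ , i′ , p′ , q′) with at-injective F (trans p (sym p′))
... | refl , refl = trans (sym q) q′

-- Every vertex has as many out-arcs as there are factors, so covering all arcs leaves no room for repetition.
factorization : ∀ {m k} → suc k ≡ 2 * m → (F : Fin k → Factor m) →
                (∀ x y → x ≢ y → ∃ λ f → Arc (F f) x y) → CmFactorization m (2 * m)
factorization {m} {k} k+1≡2m F cov = record
  { k       = k
  ; factor  = toCmFactor ∘ F
  ; covered = cov
  ; unique  = λ x y f f′ j j′ i i′ a a′ →
      unique′ a a′ (unique-index k+1≡2m (λ f → Arc (F f) x) (λ {f} → Arc-functional (F f)) x (cov x)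
                     (j , i , a) (j′ , i′ , a′))
  }
  where
  unique′ : ∀ {x y} {f f′ : Fin k} {j j′ : Fin 2} {i i′ : Fin m} →
            at (F f) j i ≡ x × at (F f) j (next i) ≡ y →
            at (F f′) j′ i′ ≡ x × at (F f′) j′ (next i′) ≡ y → f ≡ f′ →
            Σ[ e ∈ f ≡ f′ ] (subst (λ _ → Fin 2) e j ≡ j′) × (i ≡ i′)
  unique′ {f = f} (p , _) (p′ , _) refl = refl , at-injective (F f) (trans p (sym p′))

-- The cyclic successor and its reversal

toℕ-next : ∀ {n} (i : Fin (suc n)) → toℕ i < n → toℕ (next i) ≡ suc (toℕ i)
toℕ-next i i<n = trans (Finₚ.toℕ-fromℕ< (m%n<n (suc (toℕ i)) _)) (m<n⇒m%n≡m (s≤s i<n))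

toℕ-next-last : ∀ {n} (i : Fin (suc n)) → toℕ i ≡ n → toℕ (next i) ≡ 0
toℕ-next-last {n} i i≡n = trans (Finₚ.toℕ-fromℕ< (m%n<n (suc (toℕ i)) _))
  (trans (cong (λ z → suc z % suc n) i≡n) (n%n≡0 (suc n)))

next-split : ∀ {n} (i : Fin (suc n)) →
             toℕ i < n × toℕ (next i) ≡ suc (toℕ i) ⊎ toℕ i ≡ n × toℕ (next i) ≡ 0
next-split i with ℕₚ.m≤n⇒m<n∨m≡n (s≤s⁻¹ (Finₚ.toℕ<n i))
... | inj₁ i<n = inj₁ (i<n , toℕ-next i i<n)
... | inj₂ i≡n = inj₂ (i≡n , toℕ-next-last i i≡n)

-- This is what makes `opposite` reverse a cycle: the arc from `i` to `next i` becomes one from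
-- `opposite (next i)` to `opposite i`.
next-opposite-next : ∀ {m} (i : Fin m) → next (opposite (next i)) ≡ opposite i
next-opposite-next {suc n} i with next-split i | next-split (opposite (next i))
... | inj₁ (i<n , q) | inj₁ (_ , q′) = Finₚ.toℕ-injective (begin
  toℕ (next (opposite (next i)))  ≡⟨ q′ ⟩
  suc (toℕ (opposite (next i)))   ≡⟨ cong suc (Finₚ.opposite-prop (next i)) ⟩
  suc (n ∸ toℕ (next i))          ≡⟨ cong (λ z → suc (n ∸ z)) q ⟩
  suc (n ∸ suc (toℕ i))           ≡⟨ ℕₚ.+-∸-assoc 1 i<n ⟨
  n ∸ toℕ i                       ≡⟨ Finₚ.opposite-prop i ⟨
  toℕ (opposite i)                ∎)
  where open ≡-Reasoning
... | inj₁ (i<n , q) | inj₂ (p′ , _) = ⊥-elim (ℕₚ.<-irrefl p (ℕₚ.∸-monoʳ-< {n} (s≤s z≤n) i<n))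
  where
  p : n ∸ suc (toℕ i) ≡ n
  p = trans (cong (n ∸_) (sym q)) (trans (sym (Finₚ.opposite-prop (next i))) p′)
... | inj₂ (_ , q) | inj₁ (p′ , _) = ⊥-elim (ℕₚ.<-irrefl
  (trans (Finₚ.opposite-prop (next i)) (cong (n ∸_) q)) p′)
... | inj₂ (p , _) | inj₂ (_ , q′) = Finₚ.toℕ-injective
  (trans q′ (sym (trans (Finₚ.opposite-prop i) (trans (cong (n ∸_) p) (ℕₚ.n∸n≡0 n)))))

-- Walecki's decomposition

half : ℕ → ℕ ⊎ ℕ
half 0             = inj₁ 0
half 1             = inj₂ 0
half (suc (suc n)) = map suc suc (half n)

half-even : ∀ k → half (k + k) ≡ inj₁ k
half-even zero    = refl
half-even (suc k) rewrite ℕₚ.+-suc k k | half-even k = refl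

half-odd : ∀ k → half (suc (k + k)) ≡ inj₂ k
half-odd zero    = refl
half-odd (suc k) rewrite ℕₚ.+-suc k k | half-odd k = refl

half-sound : ∀ n → (∃ λ k → n ≡ k + k) ⊎ (∃ λ k → n ≡ suc (k + k))
half-sound 0             = inj₁ (0 , refl)
half-sound 1             = inj₂ (0 , refl)
half-sound (suc (suc n)) = map
  (λ (k , eq) → suc k , cong suc (trans (cong suc eq) (sym (ℕₚ.+-suc k k))))
  (λ (k , eq) → suc k , cong suc (cong suc (trans eq (sym (ℕₚ.+-suc k k)))))
  (half-sound n)

module Walecki (h : ℕ) where

  m : ℕ
  m = suc (h + h)

  -- Positions 0, 1, …, 2h−1 of the i-th Hamiltonian cycle carry the labels i, i+1, i−1, i+2, … modulo 2h;
  -- position 2h carries the label 2h, which plays the part of ∞.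
  label : ℕ → ℕ → ℕ
  label i p with p ℕₚ.≟ h + h | half p
  ... | yes _ | _ = h + h
  ... | no  _ | inj₂ k = i + suc k
  ... | no  _ | inj₁ k with k ≤? i
  ...   | yes _ = i ∸ k
  ...   | no  _ = i + (h + h) ∸ k

  label-∞ : ∀ i → label i (h + h) ≡ h + h
  label-∞ i with h + h ℕₚ.≟ h + h | half (h + h)
  ... | yes _ | _ = refl
  ... | no ¬p | _ = contradiction refl ¬p

  label-odd : ∀ i k → suc (k + k) < h + h → label i (suc (k + k)) ≡ i + suc k
  label-odd i k p<2h with suc (k + k) ℕₚ.≟ h + h | half (suc (k + k)) | half-odd k
  ... | yes eq | _ | _ = contradiction p<2h (ℕₚ.<-irrefl eq)
  ... | no _ | _ | refl = refl

  -- The label i - k modulo 2h is specified by a sum, without subtraction; the second alternative is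
  -- the one that has wrapped round below 0.
  label-even : ∀ i k {u} → k + k < h + h → u + k ≡ i ⊎ (u + k ≡ i + (h + h) × i < k) → label i (k + k) ≡ u
  label-even i k {u} p<2h e with k + k ℕₚ.≟ h + h | half (k + k) | half-even k
  ... | yes eq | _ | _ = contradiction p<2h (ℕₚ.<-irrefl eq)
  label-even i k {u} p<2h e | no _ | _ | refl with k ≤? i | e
  ... | yes _   | inj₁ eq        = trans (cong (_∸ k) (sym eq)) (ℕₚ.m+n∸n≡m u k)
  ... | yes k≤i | inj₂ (_ , i<k) = contradiction k≤i (ℕₚ.<⇒≱ i<k)
  ... | no  k≰i | inj₁ eq        = contradiction (ℕₚ.≤-trans (ℕₚ.m≤n+m k u) (ℕₚ.≤-reflexive eq)) k≰i
  ... | no  _   | inj₂ (eq , _)  = trans (cong (_∸ k) (sym eq)) (ℕₚ.m+n∸n≡m u k)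

  clip : ℕ → Fin m
  clip x = fromℕ< (m%n<n x m)

  clip-toℕ : ∀ {x} (u : Fin m) → x ≡ toℕ u → clip x ≡ u
  clip-toℕ u refl = Finₚ.toℕ-injective
    (trans (Finₚ.toℕ-fromℕ< (m%n<n (toℕ u) m)) (m<n⇒m%n≡m (Finₚ.toℕ<n u)))

  vertex : ℕ → Fin m → Fin m
  vertex i p = clip (label i (toℕ p))

  vertex-clip : ∀ i {p} (u : Fin m) → p < m → label i p ≡ toℕ u → vertex i (clip p) ≡ u
  vertex-clip i u p<m eq = clip-toℕ u
    (trans (cong (label i) (trans (Finₚ.toℕ-fromℕ< _) (m<n⇒m%n≡m p<m))) eq)

  Adjacent : ℕ → Fin m → Fin m → Set
  Adjacent i u v = ∃ λ p → vertex i p ≡ u × vertex i (next p) ≡ v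

  toℕ-clip : ∀ {p} → p < m → toℕ (clip p) ≡ p
  toℕ-clip p<m = trans (Finₚ.toℕ-fromℕ< _) (m<n⇒m%n≡m p<m)

  adjacent-step : ∀ i p {u v} → p < h + h → label i p ≡ toℕ u → label i (suc p) ≡ toℕ v → Adjacent i u v
  adjacent-step i p {u} {v} p<2h eu ev = clip p , vertex-clip i u (ℕₚ.m<n⇒m<1+n p<2h) eu ,
    clip-toℕ v (trans (cong (label i) next-clip) ev)
    where
    c = toℕ-clip (ℕₚ.m<n⇒m<1+n p<2h)
    next-clip : toℕ (next (clip p)) ≡ suc p
    next-clip = trans (toℕ-next (clip p) (subst (_< h + h) (sym c) p<2h)) (cong suc c)

  adjacent-last : ∀ i {u v} → h + h ≡ toℕ u → label i 0 ≡ toℕ v → Adjacent i u v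
  adjacent-last i {u} {v} eu ev = clip (h + h) ,
    vertex-clip i u ℕₚ.≤-refl (trans (label-∞ i) eu) ,
    clip-toℕ v (trans (cong (label i) (toℕ-next-last (clip (h + h)) (toℕ-clip ℕₚ.≤-refl))) ev)

  double-< : ∀ {k} → k < h → k + k < h + h
  double-< k<h = ℕₚ.+-mono-< k<h k<h

  double-suc-< : ∀ {k} → k < h → suc (k + k) < h + h
  double-suc-< {k} k<h = ℕₚ.≤-trans (ℕₚ.≤-reflexive (cong suc (sym (ℕₚ.+-suc k k)))) (ℕₚ.+-mono-≤ k<h k<h)

  double-cancel-< : ∀ {k} → k + k < h + h → k < h
  double-cancel-< {k} p with k ℕₚ.<? h
  ... | yes k<h = k<h
  ... | no  k≮h = contradiction p (ℕₚ.≤⇒≯ (ℕₚ.+-mono-≤ (ℕₚ.≮⇒≥ k≮h) (ℕₚ.≮⇒≥ k≮h)))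

  vertex-onto : ∀ i → i < h → ∀ u → ∃ λ p → vertex i p ≡ u
  vertex-onto i i<h u with ℕₚ.m≤n⇒m<n∨m≡n (s≤s⁻¹ (Finₚ.toℕ<n u))
  ... | inj₂ u≡2h = clip (h + h) , vertex-clip i u ℕₚ.≤-refl (trans (label-∞ i) (sym u≡2h))
  ... | inj₁ u<2h with toℕ u ≤? i
  ...   | yes u≤i = clip (k + k) , vertex-clip i u (ℕₚ.m<n⇒m<1+n 2k<2h)
                     (label-even i k 2k<2h (inj₁ (ℕₚ.m+[n∸m]≡n u≤i)))
    where
    k = i ∸ toℕ u
    2k<2h = double-< (ℕₚ.≤-<-trans (ℕₚ.m∸n≤m i (toℕ u)) i<h)
  ...   | no u≰i with toℕ u ∸ suc i ℕₚ.<? h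
  ...     | yes d<h = clip (suc (d + d)) , vertex-clip i u (ℕₚ.m<n⇒m<1+n (double-suc-< d<h))
                       (trans (label-odd i d (double-suc-< d<h)) (trans (ℕₚ.+-suc i d) (ℕₚ.m+[n∸m]≡n (ℕₚ.≰⇒> u≰i))))
    where d = toℕ u ∸ suc i
  -- The odd positions carry i + 1, ..., i + h. A label beyond these is i - k + 2h, at an even
  -- position.
  ...     | no d≮h = clip (k + k) , vertex-clip i u (ℕₚ.m<n⇒m<1+n 2k<2h)
                       (label-even i k 2k<2h (inj₂ (u+k≡i+2h , i<k)))
    where
    d = toℕ u ∸ suc i
    k = i + (h + h) ∸ toℕ u
    u+k≡i+2h : toℕ u + k ≡ i + (h + h)
    u+k≡i+2h = ℕₚ.m+[n∸m]≡n (ℕₚ.≤-trans (ℕₚ.<⇒≤ u<2h) (ℕₚ.m≤n+m (h + h) i))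
    i<k : i < k
    i<k = ℕₚ.+-cancelˡ-< (toℕ u) i k (subst (toℕ u + i <_) (trans (ℕₚ.+-comm (h + h) i) (sym u+k≡i+2h))
            (ℕₚ.+-monoˡ-< i u<2h))
    i+h<u : suc i + h ≤ toℕ u
    i+h<u = ℕₚ.≤-trans (ℕₚ.+-monoʳ-≤ (suc i) (ℕₚ.≮⇒≥ d≮h)) (ℕₚ.≤-reflexive (ℕₚ.m+[n∸m]≡n (ℕₚ.≰⇒> u≰i)))
    k<h : k < h
    k<h = ℕₚ.+-cancelˡ-< (toℕ u) k h (subst (_< toℕ u + h) (sym (trans u+k≡i+2h (sym (ℕₚ.+-assoc i h h))))
            (ℕₚ.+-monoˡ-< h i+h<u))
    2k<2h = double-< k<h

  -- The zigzag of index i starts at i and ends at i + h, and these are the neighbours of ∞ on it;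
  -- so u is a start if u < h and an end otherwise.
  adjacent-∞ : ∀ {u v} → toℕ u < h + h → toℕ v ≡ h + h → ∃ λ i → i < h × (Adjacent i u v ⊎ Adjacent i v u)
  adjacent-∞ {u} {v} u<2h v≡2h with toℕ u ℕₚ.<? h
  ... | yes u<h = toℕ u , u<h , inj₂ (adjacent-last (toℕ u) (sym v≡2h)
                   (label-even (toℕ u) 0 (ℕₚ.≤-<-trans z≤n u<2h) (inj₁ (ℕₚ.+-identityʳ (toℕ u)))))
  ... | no  u≮h = i , i<h , inj₁ (from-pred h refl)
    where
    i = toℕ u ∸ h
    h+i≡u = ℕₚ.m+[n∸m]≡n (ℕₚ.≮⇒≥ u≮h)
    i<h = ℕₚ.+-cancelˡ-< h i h (subst (_< h + h) (sym h+i≡u) u<2h)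
    from-pred : ∀ g → g ≡ h → Adjacent i u v
    from-pred zero    refl = contradiction i<h λ ()
    from-pred (suc g) refl = adjacent-step i (suc (g + g)) (double-suc-< ℕₚ.≤-refl)
      (trans (label-odd i g (double-suc-< ℕₚ.≤-refl)) (trans (ℕₚ.+-comm i (suc g)) h+i≡u))
      (trans (cong (label i ∘ suc) (sym (ℕₚ.+-suc g g))) (trans (label-∞ i) (sym v≡2h)))

  -- With c the midpoint of u and v (rounded down), the edge uv lies on the cycle of index c or c − h.
  adjacent-< : ∀ {u v} → toℕ u < toℕ v → toℕ v < h + h → ∃ λ i → i < h × (Adjacent i u v ⊎ Adjacent i v u)
  adjacent-< {u} {v} u<v v<2h with half-sound (toℕ v ∸ suc (toℕ u))
  ... | inj₁ (k , d≡2k) = case-odd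
    where
    a = toℕ u
    b = toℕ v
    b≡ : suc a + (k + k) ≡ b
    b≡ = trans (cong (suc a +_) (sym d≡2k)) (ℕₚ.m+[n∸m]≡n u<v)
    k<h : k < h
    k<h = double-cancel-< (ℕₚ.≤-<-trans (ℕₚ.m≤n+m (k + k) (suc a)) (subst (_< h + h) (sym b≡) v<2h))
    case-odd : ∃ λ i → i < h × (Adjacent i u v ⊎ Adjacent i v u)
    case-odd with a + k ℕₚ.<? h
    ... | yes c<h = a + k , c<h , inj₁ (adjacent-step (a + k) (k + k) (double-< k<h)
                      (label-even (a + k) k (double-< k<h) (inj₁ refl))
                      (trans (label-odd (a + k) k (double-suc-< k<h)) (trans (eq a k) b≡)))
      where
      eq : ∀ a k → a + k + suc k ≡ suc a + (k + k)
      eq = solve-∀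
    ... | no  c≮h = i , ℕₚ.<-trans i<w w<h , inj₂ (adjacent-step i (w + w) (double-< w<h)
                      (label-even i w (double-< w<h) (inj₂ (b+w , i<w)))
                      (trans (label-odd i w (double-suc-< w<h)) (ℕₚ.+-cancelʳ-≡ (h + k) _ _ a-eq)))
      where
      i = a + k ∸ h
      -- The other arc of the 2h-gon between the two labels has length 2h - (2k + 1) = 2w + 1, and
      -- the zigzag of index c - h is centred on that arc.
      w = h ∸ suc k
      h+i : h + i ≡ a + k
      h+i = ℕₚ.m+[n∸m]≡n (ℕₚ.≮⇒≥ c≮h)
      k+w : suc k + w ≡ h
      k+w = ℕₚ.m+[n∸m]≡n k<h
      w<h : w < h
      w<h = subst (w <_) k+w (s≤s (ℕₚ.m≤n+m w k))
      b+w : b + w ≡ i + (h + h)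
      b+w = begin
        b + w                      ≡⟨ cong (_+ w) b≡ ⟨
        suc a + (k + k) + w        ≡⟨ eq a k w ⟩
        (a + k) + (suc k + w)      ≡⟨ cong₂ _+_ (sym h+i) k+w ⟩
        h + i + h                  ≡⟨ eq′ h i ⟩
        i + (h + h)                ∎
        where
        open ≡-Reasoning
        eq : ∀ a k w → suc a + (k + k) + w ≡ (a + k) + (suc k + w)
        eq = solve-∀
        eq′ : ∀ h i → h + i + h ≡ i + (h + h)
        eq′ = solve-∀
      i<w : i < w
      i<w = ℕₚ.+-cancelʳ-< (h + h) i w (subst (_< w + (h + h)) b+w
              (subst (b + w <_) (ℕₚ.+-comm (h + h) w) (ℕₚ.+-monoˡ-< w v<2h)))
      a-eq : i + suc w + (h + k) ≡ a + (h + k)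
      a-eq = begin
        i + suc w + (h + k)        ≡⟨ eq i w h k ⟩
        (h + i) + (suc k + w)      ≡⟨ cong₂ _+_ h+i k+w ⟩
        a + k + h                  ≡⟨ eq′ a k h ⟩
        a + (h + k)                ∎
        where
        open ≡-Reasoning
        eq : ∀ i w h k → i + suc w + (h + k) ≡ (h + i) + (suc k + w)
        eq = solve-∀
        eq′ : ∀ a k h → a + k + h ≡ a + (h + k)
        eq′ = solve-∀
  ... | inj₂ (k , d≡2k+1) = case-even
    where
    a = toℕ u
    b = toℕ v
    b≡ : a + (suc k + suc k) ≡ b
    b≡ = trans (trans (eq a k) (cong (suc a +_) (sym d≡2k+1))) (ℕₚ.m+[n∸m]≡n u<v)
      where
      eq : ∀ a k → a + (suc k + suc k) ≡ suc a + suc (k + k)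
      eq = solve-∀
    k<h : suc k < h
    k<h = double-cancel-< (ℕₚ.≤-<-trans (ℕₚ.m≤n+m (suc k + suc k) a) (subst (_< h + h) (sym b≡) v<2h))
    2k+2 : suc (suc (k + k)) ≡ suc k + suc k
    2k+2 = cong suc (sym (ℕₚ.+-suc k k))
    case-even : ∃ λ i → i < h × (Adjacent i u v ⊎ Adjacent i v u)
    case-even with a + suc k ℕₚ.<? h
    ... | yes c<h = i , c<h , inj₂ (adjacent-step i (suc (k + k)) 2k+1<2h
                      (trans (label-odd i k 2k+1<2h) (trans (ℕₚ.+-assoc a (suc k) (suc k)) b≡))
                      (trans (cong (label i) 2k+2) (label-even i (suc k) (double-< k<h) (inj₁ refl))))
      where
      i = a + suc k
      2k+1<2h = double-suc-< (ℕₚ.<-trans ℕₚ.≤-refl k<h)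
    ... | no  c≮h = i , ℕₚ.<-trans i<w w<h , inj₁ (adjacent-step i (suc (g + g)) 2g+1<2h
                      (trans (label-odd i g 2g+1<2h) (trans (cong (i +_) g+1≡w) (ℕₚ.+-cancelʳ-≡ (h + suc k) _ _ a-eq)))
                      (trans (cong (label i) (trans (cong suc (sym (ℕₚ.+-suc g g))) (cong (λ z → z + z) g+1≡w)))
                             (label-even i w (double-< w<h) (inj₂ (b+w , i<w)))))
      where
      i = a + suc k ∸ h
      w = h ∸ suc k
      -- The complementary arc now has length 2w, and the edge joins positions 2w - 1 and 2w; `g` is
      -- w - 1, the form in which `label-odd` takes the odd position.
      g = h ∸ suc (suc k)
      g+1≡w : suc g ≡ w
      g+1≡w = sym (ℕₚ.+-∸-assoc 1 k<h)
      h+i : h + i ≡ a + suc k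
      h+i = ℕₚ.m+[n∸m]≡n (ℕₚ.≮⇒≥ c≮h)
      k+w : suc k + w ≡ h
      k+w = ℕₚ.m+[n∸m]≡n (ℕₚ.<⇒≤ k<h)
      w<h : w < h
      w<h = subst (w <_) k+w (s≤s (ℕₚ.m≤n+m w k))
      2g+1<2h = double-suc-< (ℕₚ.<-trans (subst (g <_) g+1≡w ℕₚ.≤-refl) w<h)
      b+w : b + w ≡ i + (h + h)
      b+w = begin
        b + w                        ≡⟨ cong (_+ w) b≡ ⟨
        a + (suc k + suc k) + w      ≡⟨ eq a k w ⟩
        (a + suc k) + (suc k + w)    ≡⟨ cong₂ _+_ (sym h+i) k+w ⟩
        h + i + h                    ≡⟨ eq′ h i ⟩
        i + (h + h)                  ∎
        where
        open ≡-Reasoning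
        eq : ∀ a k w → a + (suc k + suc k) + w ≡ (a + suc k) + (suc k + w)
        eq = solve-∀
        eq′ : ∀ h i → h + i + h ≡ i + (h + h)
        eq′ = solve-∀
      i<w : i < w
      i<w = ℕₚ.+-cancelʳ-< (h + h) i w (subst (_< w + (h + h)) b+w
              (subst (b + w <_) (ℕₚ.+-comm (h + h) w) (ℕₚ.+-monoˡ-< w v<2h)))
      a-eq : i + w + (h + suc k) ≡ a + (h + suc k)
      a-eq = begin
        i + w + (h + suc k)        ≡⟨ eq i w h k ⟩
        (h + i) + (suc k + w)      ≡⟨ cong₂ _+_ h+i k+w ⟩
        a + suc k + h              ≡⟨ eq′ a k h ⟩
        a + (h + suc k)            ∎
        where
        open ≡-Reasoning
        eq : ∀ i w h k → i + w + (h + suc k) ≡ (h + i) + (suc k + w)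
        eq = solve-∀
        eq′ : ∀ a k h → a + suc k + h ≡ a + (h + suc k)
        eq′ = solve-∀

  adjacent-ordered : ∀ {u v} → toℕ u < toℕ v → ∃ λ i → i < h × (Adjacent i u v ⊎ Adjacent i v u)
  adjacent-ordered {u} {v} u<v with ℕₚ.m≤n⇒m<n∨m≡n (s≤s⁻¹ (Finₚ.toℕ<n v))
  ... | inj₁ v<2h = adjacent-< u<v v<2h
  ... | inj₂ v≡2h = adjacent-∞ (subst (toℕ u <_) v≡2h u<v) v≡2h

  adjacent : ∀ u v → u ≢ v → ∃ λ i → i < h × (Adjacent i u v ⊎ Adjacent i v u)
  adjacent u v u≢v with ℕₚ.<-cmp (toℕ u) (toℕ v)
  ... | tri< u<v _ _ = adjacent-ordered u<v
  ... | tri≈ _ eq _  = contradiction (Finₚ.toℕ-injective eq) u≢v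
  ... | tri> _ _ v<u with adjacent-ordered v<u
  ...   | i , i<h , inj₁ x = i , i<h , inj₂ x
  ...   | i , i<h , inj₂ x = i , i<h , inj₁ x

  -- Transversals of the levels and the four factors above one zigzag

  hue : ℕ → Fin 3
  hue p with p ℕₚ.≟ h + h | half p
  ... | yes _ | _      = suc (suc zero)
  ... | no  _ | inj₁ _ = zero
  ... | no  _ | inj₂ _ = suc zero

  hue-suc : ∀ p → p < h + h → hue p ≢ hue (suc p)
  hue-suc p p<2h with p ℕₚ.≟ h + h | suc p ℕₚ.≟ h + h | half-sound p
  ... | yes e | _     | _ = contradiction p<2h (ℕₚ.<-irrefl e)
  ... | no _  | yes _ | inj₁ (k , refl) rewrite half-even k = λ ()
  ... | no _  | yes _ | inj₂ (k , refl) rewrite half-odd k  = λ ()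
  ... | no _  | no _  | inj₁ (k , refl) rewrite half-even k | half-odd k = λ ()
  ... | no _  | no _  | inj₂ (k , refl) rewrite half-odd k | half-even k = λ ()

  hue-last : 0 < h → hue (h + h) ≢ hue 0
  hue-last 0<h with h + h ℕₚ.≟ h + h | 0 ℕₚ.≟ h + h
  ... | no ¬e | _     = contradiction refl ¬e
  ... | yes _ | yes e = contradiction (ℕₚ.+-mono-< 0<h 0<h) (ℕₚ.<-irrefl e)
  ... | yes _ | no _  = λ ()

  colour : Fin m → Fin 3
  colour p = hue (toℕ p)

  colour-next : 0 < h → ∀ p → colour p ≢ colour (next p)
  colour-next 0<h p with next-split p
  ... | inj₁ (p<2h , q) = λ eq → hue-suc (toℕ p) p<2h (trans eq (cong hue q))
  ... | inj₂ (p≡2h , q) = λ eq → hue-last 0<h (trans (sym (cong hue p≡2h)) (trans eq (cong hue q)))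

  -- The four rows 000, 011, 101, 110 are the words of even weight, an orthogonal array of strength
  -- two: any two different colours see every pair of levels once. Three colours are needed because
  -- H_i is a cycle of odd length.
  level : Fin 4 → Fin 3 → Fin 2
  level zero                   _                = zero
  level (suc zero)             zero             = zero
  level (suc zero)             (suc _)          = suc zero
  level (suc (suc zero))       (suc zero)       = zero
  level (suc (suc zero))       _                = suc zero
  level (suc (suc (suc zero))) (suc (suc zero)) = zero
  level (suc (suc (suc zero))) _                = suc zero

  abstract
    level-orthogonal : ∀ c c′ → c ≢ c′ → ∀ a b → ∃ λ k → level k c ≡ a × level k c′ ≡ b
    level-orthogonal = from-yes (Finₚ.all? λ c → Finₚ.all? λ c′ → ¬? (c ≟ c′) →-dec
      Finₚ.all? λ a → Finₚ.all? λ b → Finₚ.any? λ k → (level k c ≟ a) ×-dec (level k c′ ≟ b))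

  opposite≢ : ∀ {a b : Fin 2} → a ≢ b → opposite a ≡ b
  opposite≢ {zero}     {zero}     ne = contradiction refl ne
  opposite≢ {zero}     {suc zero} ne = refl
  opposite≢ {suc zero} {zero}     ne = refl
  opposite≢ {suc zero} {suc zero} ne = contradiction refl ne

  rowFactor : ∀ i → i < h → Fin 4 → Factor m
  rowFactor i i<h k = record { at = at′ ; onto = onto′ }
    where
    at′ : Fin 2 → Fin m → Fin (2 * m)
    at′ zero    p = combine (level k (colour p)) (vertex i p)
    at′ (suc _) p = combine (opposite (level k (colour (opposite p)))) (vertex i (opposite p))

    onto′ : ∀ v → ∃₂ λ j p → at′ j p ≡ v
    onto′ v with Finₚ.combine-surjective {2} {m} v
    ... | a , u , refl with vertex-onto i i<h u
    ...   | p , refl with level k (colour p) ≟ a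
    ...     | yes refl = zero , p , refl
    ...     | no  ne   = suc zero , opposite p ,
      cong₂ combine (trans (cong (opposite ∘ level k ∘ colour) (Finₚ.opposite-involutive p)) (opposite≢ ne))
                    (cong (vertex i) (Finₚ.opposite-involutive p))

  rowFactor-covers : ∀ {i} (i<h : i < h) {u v} → Adjacent i u v ⊎ Adjacent i v u → ∀ a b →
                     ∃ λ k → Arc (rowFactor i i<h k) (combine a u) (combine b v)
  rowFactor-covers i<h (inj₁ (p , refl , refl)) a b =
    let k , ea , eb = level-orthogonal _ _ (colour-next (ℕₚ.≤-<-trans z≤n i<h) p) a b
    in k , zero , p , cong (λ z → combine z (vertex _ p)) ea , cong (λ z → combine z (vertex _ (next p))) eb
  rowFactor-covers {i} i<h (inj₂ (p , refl , refl)) a b =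
    -- The second cycle carries the complementary levels backwards, so the first must have
    -- `opposite b` at `p` and `opposite a` at `next p`.
    let k , eb , ea = level-orthogonal _ _ (colour-next (ℕₚ.≤-<-trans z≤n i<h) p) (opposite b) (opposite a)
        back = λ q → Finₚ.opposite-involutive {m} q
    in k , suc zero , opposite (next p) ,
       cong₂ combine (trans (cong (opposite ∘ level k ∘ colour) (back (next p)))
                            (trans (cong opposite ea) (Finₚ.opposite-involutive a)))
                     (cong (vertex i) (back (next p))) ,
       trans (cong (λ q → combine (opposite (level k (colour (opposite q)))) (vertex i (opposite q))) (next-opposite-next p))
         (cong₂ combine (trans (cong (opposite ∘ level k ∘ colour) (back p))
                               (trans (cong opposite eb) (Finₚ.opposite-involutive b)))
                        (cong (vertex i) (back p)))

-- The arcs above H₀ and H₁ and between the levels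

record Special (h : ℕ) : Set where
  open Walecki h
  field
    factors   : Fin 9 → Factor m
    verticals : ∀ (a : Fin 2) (u : Fin m) → ∃ λ f → Arc (factors f) (combine a u) (combine (opposite a) u)
    edges     : ∀ {i u v} → i < 2 → Adjacent i u v ⊎ Adjacent i v u → ∀ (a b : Fin 2) →
                ∃ λ f → Arc (factors f) (combine a u) (combine b v)
open Special

module Places (h : ℕ) (2≤h : 2 ≤ h) where
  open Walecki h

  place : ℕ → Fin m
  place p = vertex 0 (clip p)

  label₀-bound : ∀ p → p ≤ h + h → label 0 p < m
  label₀-bound p p≤2h with ℕₚ.m≤n⇒m<n∨m≡n p≤2h
  ... | inj₂ refl = subst (_< m) (sym (label-∞ 0)) ℕₚ.≤-refl
  ... | inj₁ p<2h with half-sound p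
  ...   | inj₂ (k , refl) = subst (_< m) (sym (label-odd 0 k p<2h))
                              (s≤s (ℕₚ.≤-trans (s≤s (ℕₚ.m≤m+n k k)) (ℕₚ.<⇒≤ p<2h)))
  ...   | inj₁ (zero , refl) = subst (_< m) (sym (label-even 0 0 p<2h (inj₁ refl))) (s≤s z≤n)
  ...   | inj₁ (suc k , refl) = subst (_< m) (sym (label-even 0 (suc k) p<2h (inj₂ (ℕₚ.m∸n+n≡m k≤2h , s≤s z≤n))))
                                  (s≤s (ℕₚ.m∸n≤m (h + h) (suc k)))
    where k≤2h = ℕₚ.≤-trans (ℕₚ.m≤m+n (suc k) (suc k)) (ℕₚ.<⇒≤ p<2h)

  toℕ-place : ∀ p → p ≤ h + h → toℕ (place p) ≡ label 0 p
  toℕ-place p p≤2h = trans (toℕ-clip (subst (_< m) (sym eq) (label₀-bound p p≤2h))) eq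
    where eq = cong (label 0) (toℕ-clip {p} (s≤s p≤2h))

  0<h : 0 < h
  0<h = ℕₚ.≤-trans (s≤s z≤n) 2≤h

  -- If the vertex at position p of H₀ is followed by that at position q when running along H₁, then Leap p q.
  data Leap : ℕ → ℕ → Set where
    down    : ∀ j → Leap (suc (suc j + suc j)) (j + j)
    up      : ∀ k → Leap (k + k) (suc (suc (suc k) + suc (suc k)))
    first   : Leap 1 3
    penult  : ∀ g → h ≡ suc (suc g) → Leap (g + g) (suc g + suc g)
    last    : ∀ g → h ≡ suc g → Leap (g + g) (h + h)
    restart : Leap (h + h) 1

  -- Even positions carry descending labels, so raising every label by one shifts them two places
  -- back; on the ascending odd positions, in `label-shift-odd`, it shifts two places on. Leaps of 5
  -- and 3 come from combining the two.
  label-shift-even : ∀ j → suc j < h → label 1 (suc j + suc j) ≡ label 0 (j + j)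
  label-shift-even zero p = trans
    (label-even 1 1 (double-< p) (inj₁ refl)) (sym (label-even 0 0 (double-< 0<h) (inj₁ refl)))
  label-shift-even (suc j) p = trans
    (label-even 1 (suc (suc j)) (double-< p) (inj₂ (trans (ℕₚ.+-suc _ (suc j)) (cong suc eq) , s≤s (s≤s z≤n))))
    (sym (label-even 0 (suc j) (double-< j<h) (inj₂ (eq , s≤s z≤n))))
    where
    j<h = ℕₚ.<-trans ℕₚ.≤-refl p
    eq = ℕₚ.m∸n+n≡m {h + h} {suc j} (ℕₚ.≤-trans (ℕₚ.<⇒≤ j<h) (ℕₚ.m≤m+n h h))

  label-shift-odd : ∀ j → suc j < h → label 1 (suc (j + j)) ≡ label 0 (suc (suc j + suc j))
  label-shift-odd j p = trans (label-odd 1 j (double-suc-< (ℕₚ.<-trans ℕₚ.≤-refl p)))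
    (sym (label-odd 0 (suc j) (double-suc-< p)))

  -- `Leap` itself carries no bounds; `p≤` and `q≤` restrict `down` and `up` to the range in which
  -- both shift lemmas apply. The other constructors describe the turns of the zigzag at its ends
  -- and at ∞.
  leap-adjacent : ∀ {p q} → p ≤ h + h → q ≤ h + h → Leap p q → Adjacent 1 (place p) (place q)
  leap-adjacent p≤ q≤ (down j) = adjacent-step 1 (suc (j + j)) (double-suc-< (ℕₚ.<-trans ℕₚ.≤-refl j<h))
    (trans (label-shift-odd j j<h) (sym (toℕ-place _ p≤)))
    (trans (cong (label 1 ∘ suc) (sym (ℕₚ.+-suc j j))) (trans (label-shift-even j j<h) (sym (toℕ-place _ q≤))))
    where j<h = double-cancel-< p≤
  leap-adjacent p≤ q≤ (up k) = adjacent-step 1 (suc k + suc k) (double-< (ℕₚ.<-trans ℕₚ.≤-refl k<h))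
    (trans (label-shift-even k (ℕₚ.<-trans ℕₚ.≤-refl k<h)) (sym (toℕ-place _ p≤)))
    (trans (label-shift-odd (suc k) k<h) (sym (toℕ-place _ q≤)))
    where k<h = double-cancel-< q≤
  leap-adjacent p≤ q≤ first = adjacent-step 1 0 (double-< 0<h)
    (trans (label-even 1 0 (double-< 0<h) (inj₁ refl))
      (trans (sym (label-odd 0 0 (double-suc-< 0<h))) (sym (toℕ-place _ p≤))))
    (trans (label-shift-odd 0 2≤h) (sym (toℕ-place _ q≤)))
  leap-adjacent p≤ q≤ (penult g refl) = adjacent-step 1 (suc g + suc g) (double-< ℕₚ.≤-refl)
    (trans (label-shift-even g ℕₚ.≤-refl) (sym (toℕ-place _ p≤)))
    -- Position 2h - 1 of H₁ has label h + 1. In H₀ this label is on the descending side, at the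
    -- even position 2h - 2.
    (trans (label-odd 1 (suc g) (double-suc-< ℕₚ.≤-refl))
      (trans (sym (label-even 0 (suc g) {suc (suc (suc g))} (double-< ℕₚ.≤-refl) (inj₂ (eq g , s≤s z≤n))))
             (sym (toℕ-place _ q≤))))
    where
    eq : ∀ g → suc (suc (suc g)) + suc g ≡ suc (suc g) + suc (suc g)
    eq = solve-∀
  leap-adjacent p≤ q≤ (last zero refl) = contradiction 2≤h λ { (s≤s ()) }
  leap-adjacent p≤ q≤ (last (suc g) refl) = adjacent-step 1 (suc (suc g + suc g)) (double-suc-< ℕₚ.≤-refl)
    (trans (label-odd 1 (suc g) (double-suc-< ℕₚ.≤-refl))
      (trans (sym (label-even 0 (suc g) {suc (suc (suc g))} (double-< ℕₚ.≤-refl) (inj₂ (eq g , s≤s z≤n))))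
             (sym (toℕ-place _ p≤))))
    (trans (cong (label 1) (sym (cong suc (ℕₚ.+-suc (suc g) (suc g)))))
      (trans (label-∞ 1) (trans (sym (label-∞ 0)) (sym (toℕ-place _ q≤)))))
    where
    eq : ∀ g → suc (suc (suc g)) + suc g ≡ suc (suc g) + suc (suc g)
    eq = solve-∀
  leap-adjacent p≤ q≤ restart = adjacent-last 1
    (trans (sym (label-∞ 0)) (sym (toℕ-place _ p≤)))
    (trans (label-even 1 0 (double-< 0<h) (inj₁ refl))
      (trans (sym (label-odd 0 0 (double-suc-< 0<h))) (sym (toℕ-place _ q≤))))

  place-adjacent : ∀ p → p < h + h → Adjacent 0 (place p) (place (suc p))
  place-adjacent p p<2h = adjacent-step 0 p p<2h
    (sym (toℕ-place p (ℕₚ.<⇒≤ p<2h))) (sym (toℕ-place (suc p) p<2h))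

  place-adjacent-last : Adjacent 0 (place (h + h)) (place 0)
  place-adjacent-last = adjacent-last 0
    (trans (sym (label-∞ 0)) (sym (toℕ-place _ ℕₚ.≤-refl))) (sym (toℕ-place 0 z≤n))

  place-onto : ∀ u → ∃ λ p → p < m × place p ≡ u
  place-onto u = let p , eq = vertex-onto 0 0<h u in
    toℕ p , Finₚ.toℕ<n p , trans (cong (vertex 0) (clip-toℕ p refl)) eq

  vertex-injective : ∀ {i p q} → i < h → vertex i p ≡ vertex i q → p ≡ q
  vertex-injective i<h = surjective⇒injective (vertex-onto _ i<h)

  place-injective : ∀ {p q} → p < m → q < m → place p ≡ place q → p ≡ q
  place-injective p<m q<m eq = trans (sym (toℕ-clip p<m))
    (trans (cong toℕ (vertex-injective 0<h eq)) (toℕ-clip q<m))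

-- Two cycles from a successor map with an index

iterate : ∀ {A : Set} → (A → A) → A → ℕ → A
iterate f x zero    = x
iterate f x (suc n) = f (iterate f x n)

module Orbit {m : ℕ} {X : Set} (lab : X → Fin (2 * suc m)) (unlab : Fin (2 * suc m) → X)
  (lab-unlab : ∀ v → lab (unlab v) ≡ v) (unlab-lab : ∀ x → unlab (lab x) ≡ x)
  (succ : X → X) (side : X → Fin 2) (index : X → Fin (suc m))
  (side-succ : ∀ x → side (succ x) ≡ side x) (index-succ : ∀ x → index (succ x) ≡ next (index x))
  (root : Fin 2 → X) (side-root : ∀ j → side (root j) ≡ j) (index-root : ∀ j → index (root j) ≡ zero)
  where

  point : Fin 2 → Fin (suc m) → X
  point j i = iterate succ (root j) (toℕ i)

  side-iterate : ∀ j n → side (iterate succ (root j) n) ≡ j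
  side-iterate j zero    = side-root j
  side-iterate j (suc n) = trans (side-succ _) (side-iterate j n)

  toℕ-index-iterate : ∀ j n → n ≤ m → toℕ (index (iterate succ (root j) n)) ≡ n
  toℕ-index-iterate j zero    _   = cong toℕ (index-root j)
  toℕ-index-iterate j (suc n) n<m = trans (cong toℕ (index-succ x)) (trans (toℕ-next (index x) x<m) (cong suc ih))
    where
    x = iterate succ (root j) n
    ih = toℕ-index-iterate j n (ℕₚ.<⇒≤ n<m)
    x<m = subst (_< m) (sym ih) n<m

  index-point : ∀ j i → index (point j i) ≡ i
  index-point j i = Finₚ.toℕ-injective (toℕ-index-iterate j (toℕ i) (s≤s⁻¹ (Finₚ.toℕ<n i)))

  code : X → Fin (2 * suc m)
  code x = combine (side x) (index x)

  code-point : ∀ j i → code (point j i) ≡ combine j i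
  code-point j i = cong₂ combine (side-iterate j (toℕ i)) (index-point j i)

  -- The first `suc m` iterates of the two roots realise every pair of side and index, so `code` is
  -- onto; by counting, such a pair determines the state. Hence these iterates exhaust all states.
  code-injective : ∀ {x y} → code x ≡ code y → x ≡ y
  code-injective {x} {y} eq = trans (sym (unlab-lab x)) (trans (cong unlab (surjective⇒injective surj
      (trans (cong code (unlab-lab x)) (trans eq (sym (cong code (unlab-lab y))))))) (unlab-lab y))
    where
    surj : ∀ v → ∃ λ w → code (unlab w) ≡ v
    surj v with Finₚ.combine-surjective {2} {suc m} v
    ... | j , i , refl = lab (point j i) , trans (cong code (unlab-lab (point j i))) (code-point j i)

  point-code : ∀ x → point (side x) (index x) ≡ x
  point-code x = code-injective (code-point (side x) (index x))

  factor : Factor (suc m)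
  factor = record
    { at   = λ j i → lab (point j i)
    ; onto = λ v → side (unlab v) , index (unlab v) , trans (cong lab (point-code (unlab v))) (lab-unlab v)
    }

  factor-arc : ∀ x → Arc factor (lab x) (lab (succ x))
  factor-arc x = side x , index x , cong lab (point-code x) ,
    cong lab (code-injective (trans (code-point (side x) (next (index x)))
      (sym (cong₂ combine (side-succ x) (index-succ x)))))

-- 0F and 1F are the steps forward and backward along H₀, 2F and 3F those along H₁.
Dir : Set
Dir = Fin 4

-- The target level is b, except that it is x when the move leaves the repeated blocks: neighbouring blocks and the
-- ends of the strip may require different levels.
data Move : Set where
  stay : Move
  go   : Dir → (b x : Fin 2) → Move

-- The index of the vertex on its cycle is α + βK outside the K + 1 repeated blocks, and α + βk + γk̄ in the one
-- with k predecessors and k̄ successors.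
data Entry : Set where
  entry : Move → (side : Fin 2) (α β γ : ℕ) → Entry

-- The columns of the strip and the steps between them

data Shift : Set where
  down same up : Shift

data Cell (e : ℕ) : Set where
  lft : Fin 4 → Cell e
  blk : Fin 4 → Cell e
  rgt : Fin (4 + e) → Cell e
  inf : Cell e

-- The columns that can be named without knowing the number of blocks. Steps from the ends of the
-- strip reach no block but the first or the last.
data Port (e : ℕ) : Set where
  lft : Fin 4 → Port e
  fst : Fin 4 → Port e
  lst : Fin 4 → Port e
  rgt : Fin (4 + e) → Port e
  inf : Port e

leftStep : ∀ {e} → Dir → Fin 4 → Port e
leftStep 0F 0F = lft 1F
leftStep 0F 1F = lft 2F
leftStep 0F 2F = lft 3F
leftStep 0F 3F = fst 0F
leftStep 1F 0F = inf
leftStep 1F 1F = lft 0F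
leftStep 1F 2F = lft 1F
leftStep 1F 3F = lft 2F
leftStep 2F 0F = fst 1F
leftStep 2F 1F = lft 3F
leftStep 2F 2F = fst 3F
leftStep 2F 3F = lft 0F
leftStep 3F 0F = lft 3F
leftStep 3F 1F = inf
leftStep 3F 2F = fst 1F
leftStep 3F 3F = lft 1F

-- In direction `2F` even places move on by 5 and odd ones back by 3; `3F` is the inverse. Parity of
-- the place in a block is parity of the position, since blocks begin at multiples of four.
blockStep : Dir → Fin 4 → Shift × Fin 4
blockStep 0F 0F = same , 1F
blockStep 0F 1F = same , 2F
blockStep 0F 2F = same , 3F
blockStep 0F 3F = up   , 0F
blockStep 1F 0F = down , 3F
blockStep 1F 1F = same , 0F
blockStep 1F 2F = same , 1F
blockStep 1F 3F = same , 2F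
blockStep 2F 0F = up   , 1F
blockStep 2F 1F = down , 2F
blockStep 2F 2F = up   , 3F
blockStep 2F 3F = same , 0F
blockStep 3F 0F = same , 3F
blockStep 3F 1F = down , 0F
blockStep 3F 2F = up   , 1F
blockStep 3F 3F = down , 2F

infStep : ∀ {e} → Dir → Port e
infStep 0F = lft 0F
infStep 1F = rgt (opposite 0F)
infStep 2F = lft 1F
infStep 3F = rgt (opposite 1F)

-- A further block of four columns raises h by two, so the parity of h must be accommodated
-- elsewhere: the right end is longer by `e`, which is 0 or 2.
record Shape (e : ℕ) : Set where
  field
    rightStep : Dir → Fin (4 + e) → Port e
    next-rgt  : ∀ c → rightStep 0F (inject₁ c) ≡ rgt (suc c)
    last-rgt  : rightStep 0F (fromℕ (3 + e)) ≡ inf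

module Columns {e : ℕ} (shape : Shape e) (K : ℕ) where
  open Shape shape

  -- The positions 0, …, 2h on H₀: four on the left, K + 1 blocks of four, 4 + e on the right, and that of ∞.
  data Column : Set where
    lft : Fin 4 → Column
    blk : (k k̄ : ℕ) → .(k + k̄ ≡ K) → Fin 4 → Column
    rgt : Fin (4 + e) → Column
    inf : Column

  ⟦_⟧ : Port e → Column
  ⟦ lft c ⟧ = lft c
  ⟦ fst j ⟧ = blk 0 K refl j
  ⟦ lst j ⟧ = blk K 0 (ℕₚ.+-identityʳ K) j
  ⟦ rgt c ⟧ = rgt c
  ⟦ inf ⟧   = inf

  -- The left columns and the first four right ones lie where one more block would, so a step out of
  -- the blocks keeps its place `j`; only there is the level `x` used.
  shift : Shift → (k k̄ : ℕ) → .(k + k̄ ≡ K) → Fin 4 → (b x : Fin 2) → Column × Fin 2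
  shift same k       k̄       p j b x = blk k k̄ p j , b
  shift up   k       zero    p j b x = rgt (j ↑ˡ e) , x
  shift up   k       (suc k̄) p j b x = blk (suc k) k̄ (trans (sym (ℕₚ.+-suc k k̄)) p) j , b
  shift down zero    k̄       p j b x = lft j , x
  shift down (suc k) k̄       p j b x = blk k (suc k̄) (trans (ℕₚ.+-suc k k̄) p) j , b

  goTo : Dir → Column → (b x : Fin 2) → Column × Fin 2
  goTo d (lft c)        b x = ⟦ leftStep d c ⟧ , b
  goTo d (blk k k̄ p j) b x = let s , j′ = blockStep d j in shift s k k̄ p j′ b x
  goTo d (rgt c)        b x = ⟦ rightStep d c ⟧ , b
  goTo d inf            b x = ⟦ infStep d ⟧ , b

  step : Dir → Column → Column
  -- The levels are dummies: the column reached does not depend on them.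
  step d c = proj₁ (goTo d c 0F 0F)

  pos : Column → ℕ
  pos (lft c)        = toℕ c
  pos (blk k k̄ p j) = 4 + (k * 4 + toℕ j)
  pos (rgt c)        = 4 + (suc K * 4 + toℕ c)
  pos inf            = 4 + (suc K * 4 + (4 + e))

  pos-last : ∀ k j .(p : k + 0 ≡ K) → 4 + (suc k * 4 + j) ≡ 4 + (suc K * 4 + j)
  pos-last k j p = cong (λ z → 4 + (suc z * 4 + j)) (trans (sym (ℕₚ.+-identityʳ k)) (recompute (k + 0 ℕₚ.≟ K) p))

  ⟦lst⟧ : ∀ k .(p : k + 0 ≡ K) j → blk k 0 p j ≡ ⟦ lst j ⟧
  ⟦lst⟧ k p j with trans (sym (ℕₚ.+-identityʳ k)) (recompute (k + 0 ℕₚ.≟ K) p)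
  ... | refl = refl

  ⟦fst⟧ : ∀ k̄ .(p : k̄ ≡ K) j → blk 0 k̄ p j ≡ ⟦ fst j ⟧
  ⟦fst⟧ k̄ p j with recompute (k̄ ℕₚ.≟ K) p
  ... | refl = refl

  step-last : ∀ c → (∃ λ c′ → c ≡ inject₁ c′) ⊎ c ≡ fromℕ (3 + e) →
              pos (step 0F (rgt c)) ≡ suc (pos (rgt c))
  step-last _ (inj₁ (c , refl)) rewrite next-rgt c | Finₚ.toℕ-inject₁ c = cong (4 +_) (ℕₚ.+-suc (suc K * 4) (toℕ c))
  step-last _ (inj₂ refl) rewrite last-rgt | Finₚ.toℕ-fromℕ (3 + e) = cong (4 +_) (ℕₚ.+-suc (suc K * 4) (3 + e))

  inject₁-or-last : ∀ {n} (c : Fin (suc n)) → (∃ λ c′ → c ≡ inject₁ c′) ⊎ c ≡ fromℕ n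
  inject₁-or-last {zero}  zero    = inj₂ refl
  inject₁-or-last {suc n} zero    = inj₁ (zero , refl)
  inject₁-or-last {suc n} (suc c) = map (λ (c′ , eq) → suc c′ , cong suc eq) (cong suc) (inject₁-or-last c)

  pos-step : ∀ c → pos (step 0F c) ≡ suc (pos c) ⊎ c ≡ inf
  pos-step (lft 0F) = inj₁ refl
  pos-step (lft 1F) = inj₁ refl
  pos-step (lft 2F) = inj₁ refl
  pos-step (lft 3F) = inj₁ refl
  pos-step (blk k k̄ p 0F) = inj₁ (cong (4 +_) (ℕₚ.+-suc (k * 4) 0))
  pos-step (blk k k̄ p 1F) = inj₁ (cong (4 +_) (ℕₚ.+-suc (k * 4) 1))
  pos-step (blk k k̄ p 2F) = inj₁ (cong (4 +_) (ℕₚ.+-suc (k * 4) 2))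
  pos-step (blk k (suc k̄) p 3F) = inj₁ (cong (4 +_) (eq (k * 4)))
    where
    eq : ∀ n → 4 + n + 0 ≡ suc (n + 3)
    eq = solve-∀
  pos-step (blk k zero p 3F) = inj₁ (trans (sym (pos-last k 0 p)) (cong (4 +_) (eq (k * 4))))
    where
    eq : ∀ n → 4 + n + 0 ≡ suc (n + 3)
    eq = solve-∀
  pos-step (rgt c) = inj₁ (step-last c (inject₁-or-last c))
  pos-step inf = inj₂ refl

  pos-bound : ∀ c → pos c ≤ pos inf
  pos-bound (lft c) = ℕₚ.≤-trans (ℕₚ.<⇒≤ (Finₚ.toℕ<n c)) (ℕₚ.m≤m+n 4 _)
  pos-bound (blk k k̄ p j) = ℕₚ.+-monoʳ-≤ 4 (ℕₚ.+-mono-≤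
    (ℕₚ.≤-trans (ℕₚ.*-monoˡ-≤ 4 k≤K) (ℕₚ.m≤n+m (K * 4) 4))
    (ℕₚ.≤-trans (ℕₚ.<⇒≤ (Finₚ.toℕ<n j)) (ℕₚ.m≤m+n 4 e)))
    where k≤K = ℕₚ.≤-trans (ℕₚ.m≤m+n k k̄) (ℕₚ.≤-reflexive (recompute (k + k̄ ℕₚ.≟ K) p))
  pos-bound (rgt c) = ℕₚ.+-monoʳ-≤ 4 (ℕₚ.+-monoʳ-≤ (suc K * 4) (ℕₚ.<⇒≤ (Finₚ.toℕ<n c)))
  pos-bound inf = ℕₚ.≤-refl

  -- Walking along H₀ from its start inverts `pos` without a division by four.
  column : ℕ → Column
  column = iterate (step 0F) (lft 0F)

  column-blk : ∀ k k̄ .(p : k + k̄ ≡ K) j → column (4 + (k * 4 + toℕ j)) ≡ blk k k̄ p j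
  column-blk zero k̄ p 0F = sym (⟦fst⟧ k̄ p 0F)
  column-blk zero k̄ p 1F = sym (⟦fst⟧ k̄ p 1F)
  column-blk zero k̄ p 2F = sym (⟦fst⟧ k̄ p 2F)
  column-blk zero k̄ p 3F = sym (⟦fst⟧ k̄ p 3F)
  column-blk (suc k) k̄ p j =
    trans (cong (λ c → iterate (step 0F) c 4) (column-blk k (suc k̄) (trans (ℕₚ.+-suc k k̄) p) j)) (four j)
    where
    four : ∀ j → iterate (step 0F) (blk k (suc k̄) (trans (ℕₚ.+-suc k k̄) p) j) 4 ≡ blk (suc k) k̄ p j
    four 0F = refl
    four 1F = refl
    four 2F = refl
    four 3F = refl

  column-rgt : ∀ n (c : Fin (4 + e)) → toℕ c ≡ n → column (4 + (suc K * 4 + n)) ≡ rgt c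
  column-rgt zero    zero    refl =
    cong (λ c → iterate (step 0F) c 4) (column-blk K 0 (ℕₚ.+-identityʳ K) 0F)
  column-rgt (suc n) (suc c) eq = trans (cong (column ∘ (4 +_)) (ℕₚ.+-suc (suc K * 4) n))
    (trans (cong (step 0F) (column-rgt n (inject₁ c) (trans (Finₚ.toℕ-inject₁ c) (ℕₚ.suc-injective eq))))
           (cong ⟦_⟧ (next-rgt c)))

  column-pos : ∀ c → column (pos c) ≡ c
  column-pos (lft 0F) = refl
  column-pos (lft 1F) = refl
  column-pos (lft 2F) = refl
  column-pos (lft 3F) = refl
  column-pos (blk k k̄ p j) = column-blk k k̄ p j
  column-pos (rgt c) = column-rgt (toℕ c) c refl
  column-pos inf = trans (cong (column ∘ (4 +_)) (ℕₚ.+-suc (suc K * 4) (3 + e)))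
    (trans (cong (step 0F) (column-rgt (3 + e) (fromℕ (3 + e)) (Finₚ.toℕ-fromℕ (3 + e)))) (cong ⟦_⟧ last-rgt))

  pos-column : ∀ n → n ≤ pos inf → pos (column n) ≡ n
  pos-column zero _ = refl
  pos-column (suc n) n<∞ with pos-step (column n)
  ... | inj₁ eq = trans eq (cong suc (pos-column n (ℕₚ.<⇒≤ n<∞)))
  ... | inj₂ eq = contradiction n<∞ (ℕₚ.<-irrefl (trans (sym (pos-column n (ℕₚ.<⇒≤ n<∞))) (cong pos eq)))

Table : ℕ → Set
Table e = Cell e → Fin 2 → Vec Entry 9

-- Decidable conditions on a table, independent of the length of the strip

module Certificate {e : ℕ} (shape : Shape e) (table : Table e) where
  open Shape shape

  move : Entry → Move
  move (entry mv _ _ _ _) = mv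

  -- The side and the coefficients of the index α + βK.
  Form : Set
  Form = Fin 2 × ℕ × ℕ

  read : Fin 9 → Cell e → Fin 2 → Entry
  read f c a = lookup (table c a) f

  -- In the first block k = 0 and k̄ = K, so the slope in K is γ; in the last one k = K and k̄ = 0,
  -- and it is β.
  outer firstBlock lastBlock : Entry → Form
  outer      (entry _ s α β γ) = s , α , β
  firstBlock (entry _ s α β γ) = s , α , γ
  lastBlock  (entry _ s α β γ) = s , α , β

  form : Fin 9 → Port e → Fin 2 → Form
  form f (lft c) a = outer (read f (lft c) a)
  form f (fst j) a = firstBlock (read f (blk j) a)
  form f (lst j) a = lastBlock (read f (blk j) a)
  form f (rgt c) a = outer (read f (rgt c) a)
  form f inf     a = outer (read f inf a)

  -- 13 + e + 4K is the length of the cycles.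
  Follows : Form → Form → Set
  Follows (s , α , β) (s′ , α′ , β′) =
    s′ ≡ s × ((α′ ≡ suc α × β′ ≡ β) ⊎ ((suc α ≡ 13 + e × β ≡ 4) × (α′ ≡ 0 × β′ ≡ 0)))

  follows? : ∀ p q → Dec (Follows p q)
  follows? (s , α , β) (s′ , α′ , β′) = (s′ ≟ s) ×-dec
    (((α′ ℕₚ.≟ suc α) ×-dec (β′ ℕₚ.≟ β)) ⊎-dec
     (((suc α ℕₚ.≟ 13 + e) ×-dec (β ℕₚ.≟ 4)) ×-dec ((α′ ℕₚ.≟ 0) ×-dec (β′ ℕₚ.≟ 0))))

  -- Going up replaces (k , k̄ + 1) by (k + 1 , k̄); the equations avoid subtraction.
  Inside : Shift → Entry → Entry → Set
  Inside same (entry _ s α β γ) (entry _ s′ α′ β′ γ′) = s′ ≡ s × α′ ≡ suc α × β′ ≡ β × γ′ ≡ γ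
  Inside up   (entry _ s α β γ) (entry _ s′ α′ β′ γ′) = s′ ≡ s × α′ + β ≡ suc (α + γ) × β′ ≡ β × γ′ ≡ γ
  Inside down (entry _ s α β γ) (entry _ s′ α′ β′ γ′) = s′ ≡ s × α′ + γ ≡ suc (α + β) × β′ ≡ β × γ′ ≡ γ

  inside? : ∀ s x y → Dec (Inside s x y)
  inside? same (entry _ s α β γ) (entry _ s′ α′ β′ γ′) =
    (s′ ≟ s) ×-dec (α′ ℕₚ.≟ suc α) ×-dec (β′ ℕₚ.≟ β) ×-dec (γ′ ℕₚ.≟ γ)
  inside? up   (entry _ s α β γ) (entry _ s′ α′ β′ γ′) =
    (s′ ≟ s) ×-dec (α′ + β ℕₚ.≟ suc (α + γ)) ×-dec (β′ ℕₚ.≟ β) ×-dec (γ′ ℕₚ.≟ γ)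
  inside? down (entry _ s α β γ) (entry _ s′ α′ β′ γ′) =
    (s′ ≟ s) ×-dec (α′ + γ ℕₚ.≟ suc (α + β)) ×-dec (β′ ℕₚ.≟ β) ×-dec (γ′ ℕₚ.≟ γ)

  -- `Inside` is the condition for a block with a neighbour in the direction of the move, `Leaving`
  -- the one for a block without. One entry serves all blocks and must satisfy both.
  Leaving : Fin 9 → Shift → Entry → Fin 4 → Fin 2 → Set
  Leaving f same x j a = Fin 1
  Leaving f up   x j a = Follows (lastBlock x) (form f (rgt (j ↑ˡ e)) a)
  Leaving f down x j a = Follows (firstBlock x) (form f (lft j) a)

  leaving? : ∀ f s x j a → Dec (Leaving f s x j a)
  leaving? f same x j a = yes zero
  leaving? f up   x j a = follows? (lastBlock x) (form f (rgt (j ↑ˡ e)) a)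
  leaving? f down x j a = follows? (firstBlock x) (form f (lft j) a)

  BlockCorrect : Fin 9 → Fin 4 → Fin 2 → Move → Set
  BlockCorrect f j a stay       = Inside same (read f (blk j) a) (read f (blk j) (opposite a))
  BlockCorrect f j a (go d b x) = let s , j′ = blockStep d j in
    Inside s (read f (blk j) a) (read f (blk j′) b) × Leaving f s (read f (blk j) a) j′ x

  blockCorrect? : ∀ f j a mv → Dec (BlockCorrect f j a mv)
  blockCorrect? f j a stay       = inside? same (read f (blk j) a) (read f (blk j) (opposite a))
  blockCorrect? f j a (go d b x) = let s , j′ = blockStep d j in
    inside? s (read f (blk j) a) (read f (blk j′) b) ×-dec leaving? f s (read f (blk j) a) j′ x

  OuterCorrect : Fin 9 → Port e → (Dir → Port e) → Fin 2 → Move → Set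
  OuterCorrect f c st a stay       = Follows (form f c a) (form f c (opposite a))
  OuterCorrect f c st a (go d b _) = Follows (form f c a) (form f (st d) b)

  outerCorrect? : ∀ f c st a mv → Dec (OuterCorrect f c st a mv)
  outerCorrect? f c st a stay       = follows? (form f c a) (form f c (opposite a))
  outerCorrect? f c st a (go d b _) = follows? (form f c a) (form f (st d) b)

  data IsStay : Move → Set where
    isStay : IsStay stay

  data Goes (d : Dir) (b : Fin 2) : Move → Set where
    goes : ∀ {x} → Goes d b (go d b x)

  data Leaves (d : Dir) (x : Fin 2) : Move → Set where
    leaves : ∀ {b} → Leaves d x (go d b x)

  isStay? : ∀ mv → Dec (IsStay mv)
  isStay? stay       = yes isStay
  isStay? (go _ _ _) = no λ ()

  goes? : ∀ d b mv → Dec (Goes d b mv)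
  goes? d b stay = no λ ()
  goes? d b (go d′ b′ x) with d ≟ d′ | b ≟ b′
  ... | yes refl | yes refl = yes goes
  ... | no ne    | _        = no λ { goes → ne refl }
  ... | _        | no ne    = no λ { goes → ne refl }

  leaves? : ∀ d x mv → Dec (Leaves d x mv)
  leaves? d x stay = no λ ()
  leaves? d x (go d′ b x′) with d ≟ d′ | x ≟ x′
  ... | yes refl | yes refl = yes leaves
  ... | no ne    | _        = no λ { leaves → ne refl }
  ... | _        | no ne    = no λ { leaves → ne refl }

  -- These are the nine arcs out of a vertex: one between the levels and, for each of four
  -- directions, one to either level. Both the levels `b` and the levels `x` have to take all
  -- values, because the place of the block decides which of them is used.
  Complete : Cell e → Set
  Complete c = ∀ a → (∃ λ f → IsStay (move (read f c a))) ×
    (∀ d b → (∃ λ f → Goes d b (move (read f c a))) × (∃ λ f → Leaves d b (move (read f c a))))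

  complete? : ∀ c → Dec (Complete c)
  complete? c = Finₚ.all? λ a → Finₚ.any? (λ f → isStay? (move (read f c a))) ×-dec
    (Finₚ.all? λ d → Finₚ.all? λ b → Finₚ.any? (λ f → goes? d b (move (read f c a))) ×-dec
                                     Finₚ.any? (λ f → leaves? d b (move (read f c a))))

  Correct : Set
  Correct = ∀ f a →
    (∀ c → OuterCorrect f (lft c) (λ d → leftStep d c) a (move (read f (lft c) a))) ×
    (∀ c → OuterCorrect f (rgt c) (λ d → rightStep d c) a (move (read f (rgt c) a))) ×
    OuterCorrect f inf infStep a (move (read f inf a)) ×
    (∀ j → BlockCorrect f j a (move (read f (blk j) a)))

  correct? : Dec Correct
  correct? = Finₚ.all? λ f → Finₚ.all? λ a →
    (Finₚ.all? λ c → outerCorrect? f (lft c) (λ d → leftStep d c) a (move (read f (lft c) a))) ×-dec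
    (Finₚ.all? λ c → outerCorrect? f (rgt c) (λ d → rightStep d c) a (move (read f (rgt c) a))) ×-dec
    outerCorrect? f inf infStep a (move (read f inf a)) ×-dec
    (Finₚ.all? λ j → blockCorrect? f j a (move (read f (blk j) a)))

  AllComplete : Set
  AllComplete = (∀ c → Complete (lft c)) × (∀ c → Complete (blk c)) × (∀ c → Complete (rgt c)) × Complete inf

  allComplete? : Dec AllComplete
  allComplete? = (Finₚ.all? λ c → complete? (lft c)) ×-dec (Finₚ.all? λ c → complete? (blk c)) ×-dec
    (Finₚ.all? λ c → complete? (rgt c)) ×-dec complete? inf

  -- Roots are sought among the left columns, which are the same for all lengths of the strip.
  Rooted : (Fin 9 → Fin 2 → Fin 4 × Fin 2) → Set
  Rooted root = ∀ f s → form f (lft (proj₁ (root f s))) (proj₂ (root f s)) ≡ (s , 0 , 0)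

  rooted? : ∀ root → Dec (Rooted root)
  rooted? root = Finₚ.all? λ f → Finₚ.all? λ s →
    ≡-dec _≟_ (≡-dec ℕₚ._≟_ ℕₚ._≟_) (form f (lft (proj₁ (root f s))) (proj₂ (root f s))) (s , 0 , 0)

-- From a certified table to nine factors

module Realisation {e : ℕ} (shape : Shape e) (table : Table e) (root : Fin 9 → Fin 2 → Fin 4 × Fin 2)
  (correct : Certificate.Correct shape table) (complete : Certificate.AllComplete shape table)
  (rooted : Certificate.Rooted shape table root)
  (K h : ℕ) (2≤h : 2 ≤ h) (size : h + h ≡ Columns.pos shape K Columns.inf)
  (leap : ∀ c → Places.Leap h 2≤h (Columns.pos shape K c) (Columns.pos shape K (Columns.step shape K 2F c)))
  (back₀ : ∀ c → Columns.step shape K 1F (Columns.step shape K 0F c) ≡ c)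
  (back₁ : ∀ c → Columns.step shape K 3F (Columns.step shape K 2F c) ≡ c)
  where

  open Columns shape K
  open Places h 2≤h
  open Shape shape
  open Certificate shape table
  open Walecki h using (m; clip; clip-toℕ; toℕ-clip; vertex; Adjacent)

  State : Set
  State = Column × Fin 2

  cell : Column → Cell e
  cell (lft c)        = lft c
  cell (blk k k̄ p j) = blk j
  cell (rgt c)        = rgt c
  cell inf            = inf

  apply : Move → Column → Fin 2 → State
  apply stay       c a = c , opposite a
  apply (go d b x) c a = goTo d c b x

  succ : Fin 9 → State → State
  succ f (c , a) = apply (move (read f (cell c) a)) c a

  value : Form → Fin 2 × ℕ
  value (s , α , β) = s , α + β * K

  blockValue : ℕ → ℕ → Entry → Fin 2 × ℕ
  blockValue k k̄ (entry _ s α β γ) = s , α + (β * k + γ * k̄)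

  position : Fin 9 → State → Fin 2 × ℕ
  position f (lft c , a)        = value (form f (lft c) a)
  position f (blk k k̄ p j , a) = blockValue k k̄ (read f (blk j) a)
  position f (rgt c , a)        = value (form f (rgt c) a)
  position f (inf , a)          = value (form f inf a)

  blockValue-first : ∀ E → blockValue 0 K E ≡ value (firstBlock E)
  blockValue-first (entry _ s α β γ) = cong (s ,_) (cong (λ z → α + (z + γ * K)) (ℕₚ.*-zeroʳ β))

  blockValue-last : ∀ k E .(p : k + 0 ≡ K) → blockValue k 0 E ≡ value (lastBlock E)
  blockValue-last k (entry _ s α β γ) p with trans (sym (ℕₚ.+-identityʳ k)) (recompute (k + 0 ℕₚ.≟ K) p)
  ... | refl = cong (s ,_) (cong (α +_) (trans (cong (β * k +_) (ℕₚ.*-zeroʳ γ)) (ℕₚ.+-identityʳ _)))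

  position-port : ∀ f q a → position f (⟦ q ⟧ , a) ≡ value (form f q a)
  position-port f (lft c) a = refl
  position-port f (fst j) a = blockValue-first (read f (blk j) a)
  position-port f (lst j) a = blockValue-last K (read f (blk j) a) (ℕₚ.+-identityʳ K)
  position-port f (rgt c) a = refl
  position-port f inf     a = refl

  _⟶_ : Fin 2 × ℕ → Fin 2 × ℕ → Set
  (s , i) ⟶ (s′ , i′) = s′ ≡ s × (i′ ≡ suc i ⊎ (suc i ≡ m × i′ ≡ 0))

  follows-value : ∀ {p q} → Follows p q → value p ⟶ value q
  follows-value {s , α , β} (refl , inj₁ (refl , refl)) = refl , inj₁ refl
  follows-value {s , α , β} (refl , inj₂ ((α+1≡ , refl) , (refl , refl))) =
    refl , inj₂ (trans (cong (_+ 4 * K) α+1≡) (trans (eq e K) (sym (cong suc size))) , refl)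
    where
    eq : ∀ e K → 13 + e + 4 * K ≡ suc (4 + (suc K * 4 + (4 + e)))
    eq = solve-∀

  inside-same : ∀ k k̄ E E′ → Inside same E E′ → blockValue k k̄ E ⟶ blockValue k k̄ E′
  inside-same k k̄ (entry _ _ _ _ _) (entry _ _ _ _ _) (refl , refl , refl , refl) = refl , inj₁ refl

  inside-up : ∀ k k̄ E E′ → Inside up E E′ → blockValue k (suc k̄) E ⟶ blockValue (suc k) k̄ E′
  inside-up k k̄ (entry _ _ α β γ) (entry _ _ α′ _ _) (refl , eq , refl , refl) = refl , inj₁ (begin
    α′ + (β * suc k + γ * k̄)          ≡⟨ lhs α′ β k γ k̄ ⟩
    α′ + β + (β * k + γ * k̄)          ≡⟨ cong (_+ (β * k + γ * k̄)) eq ⟩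
    suc (α + γ) + (β * k + γ * k̄)     ≡⟨ rhs α β k γ k̄ ⟩
    suc (α + (β * k + γ * suc k̄))     ∎)
    where
    open ≡-Reasoning
    lhs : ∀ α′ β k γ k̄ → α′ + (β * suc k + γ * k̄) ≡ α′ + β + (β * k + γ * k̄)
    lhs = solve-∀
    rhs : ∀ α β k γ k̄ → suc (α + γ) + (β * k + γ * k̄) ≡ suc (α + (β * k + γ * suc k̄))
    rhs = solve-∀

  inside-down : ∀ k k̄ E E′ → Inside down E E′ → blockValue (suc k) k̄ E ⟶ blockValue k (suc k̄) E′
  inside-down k k̄ (entry _ _ α β γ) (entry _ _ α′ _ _) (refl , eq , refl , refl) = refl , inj₁ (begin
    α′ + (β * k + γ * suc k̄)          ≡⟨ lhs α′ β k γ k̄ ⟩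
    α′ + γ + (β * k + γ * k̄)          ≡⟨ cong (_+ (β * k + γ * k̄)) eq ⟩
    suc (α + β) + (β * k + γ * k̄)     ≡⟨ rhs α β k γ k̄ ⟩
    suc (α + (β * suc k + γ * k̄))     ∎)
    where
    open ≡-Reasoning
    lhs : ∀ α′ β k γ k̄ → α′ + (β * k + γ * suc k̄) ≡ α′ + γ + (β * k + γ * k̄)
    lhs = solve-∀
    rhs : ∀ α β k γ k̄ → suc (α + β) + (β * k + γ * k̄) ≡ suc (α + (β * suc k + γ * k̄))
    rhs = solve-∀

  shift-next : ∀ f s k k̄ .(p : k + k̄ ≡ K) E j b x →
               Inside s E (read f (blk j) b) → Leaving f s E j x →
               blockValue k k̄ E ⟶ position f (shift s k k̄ p j b x)
  shift-next f same k       k̄       p E j b x ins _   = inside-same k k̄ E _ ins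
  shift-next f up   k       zero    p E j b x _   lea =
    subst (_⟶ _) (sym (blockValue-last k E p)) (follows-value lea)
  shift-next f up   k       (suc k̄) p E j b x ins _   = inside-up k k̄ E _ ins
  shift-next f down zero    k̄       p E j b x _   lea =
    subst (_⟶ _) (sym (trans (cong (λ z → blockValue 0 z E) (recompute (k̄ ℕₚ.≟ K) p)) (blockValue-first E)))
      (follows-value lea)
  shift-next f down (suc k) k̄       p E j b x ins _   = inside-down k k̄ E _ ins

  block-next : ∀ f k k̄ .(p : k + k̄ ≡ K) j a mv → BlockCorrect f j a mv →
               position f (blk k k̄ p j , a) ⟶ position f (apply mv (blk k k̄ p j) a)
  block-next f k k̄ p j a stay       ok = inside-same k k̄ (read f (blk j) a) _ ok
  block-next f k k̄ p j a (go d b x) (ins , lea) =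
    shift-next f (proj₁ (blockStep d j)) k k̄ p (read f (blk j) a) (proj₂ (blockStep d j)) b x ins lea

  outer-next : ∀ f q st a mv → OuterCorrect f q st a mv → (∀ d b x → goTo d ⟦ q ⟧ b x ≡ (⟦ st d ⟧ , b)) →
               position f (⟦ q ⟧ , a) ⟶ position f (apply mv ⟦ q ⟧ a)
  outer-next f q st a stay ok _ =
    subst₂ _⟶_ (sym (position-port f q a)) (sym (position-port f q (opposite a))) (follows-value ok)
  outer-next f q st a (go d b x) ok go-port = subst₂ _⟶_ (sym (position-port f q a))
    (sym (trans (cong (position f) (go-port d b x)) (position-port f (st d) b))) (follows-value ok)

  succ-next : ∀ f x → position f x ⟶ position f (succ f x)
  succ-next f (lft c , a) = outer-next f (lft c) (λ d → leftStep d c) a (move (read f (lft c) a))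
    (proj₁ (correct f a) c) λ _ _ _ → refl
  succ-next f (rgt c , a) = outer-next f (rgt c) (λ d → rightStep d c) a (move (read f (rgt c) a))
    (proj₁ (proj₂ (correct f a)) c) λ _ _ _ → refl
  succ-next f (inf , a)   = outer-next f inf infStep a (move (read f inf a))
    (proj₁ (proj₂ (proj₂ (correct f a)))) λ _ _ _ → refl
  succ-next f (blk k k̄ p j , a) = block-next f k k̄ p j a (move (read f (blk j) a)) (proj₂ (proj₂ (proj₂ (correct f a))) j)

  clip-suc : ∀ i → clip (suc i) ≡ next (clip i)
  clip-suc i = Finₚ.toℕ-injective (begin
    toℕ (clip (suc i))            ≡⟨ Finₚ.toℕ-fromℕ< (m%n<n (suc i) m) ⟩
    (1 + i) % m                   ≡⟨ %-distribˡ-+ 1 i m ⟩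
    (1 % m + i % m) % m           ≡⟨ cong (λ z → (1 % m + z) % m) (m%n%n≡m%n i m) ⟨
    (1 % m + i % m % m) % m       ≡⟨ %-distribˡ-+ 1 (i % m) m ⟨
    (1 + i % m) % m               ≡⟨ cong (λ z → suc z % m) (Finₚ.toℕ-fromℕ< (m%n<n i m)) ⟨
    suc (toℕ (clip i)) % m        ≡⟨ Finₚ.toℕ-fromℕ< (m%n<n (suc (toℕ (clip i))) m) ⟨
    toℕ (next (clip i))           ∎)
    where open ≡-Reasoning

  clip-m : clip m ≡ clip 0
  clip-m = Finₚ.toℕ-injective (trans (Finₚ.toℕ-fromℕ< (m%n<n m m)) (n%n≡0 m))

  side : Fin 9 → State → Fin 2
  side f x = proj₁ (position f x)

  -- Reduction modulo `m` turns the return from m - 1 to 0 into an ordinary `next`.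
  index : Fin 9 → State → Fin m
  index f x = clip (proj₂ (position f x))

  index-succ : ∀ f x → index f (succ f x) ≡ next (index f x)
  index-succ f x with proj₂ (succ-next f x)
  ... | inj₁ eq           = trans (cong clip eq) (clip-suc _)
  ... | inj₂ (i+1≡m , eq) = trans (cong clip eq) (trans (sym clip-m) (trans (cong clip (sym i+1≡m)) (clip-suc _)))

  pos≤2h : ∀ c → pos c ≤ h + h
  pos≤2h c = subst (pos c ≤_) (sym size) (pos-bound c)

  place-column : ∀ (u : Fin m) → ∃ λ c → place (pos c) ≡ u
  place-column u = let p , p<m , eq = place-onto u in
    column p , trans (cong place (pos-column p (subst (p ≤_) size (s≤s⁻¹ p<m)))) eq

  lab : State → Fin (2 * m)
  lab (c , a) = combine a (place (pos c))

  unlab : Fin (2 * m) → State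
  unlab v = let a , u = remQuot {2} m v in proj₁ (place-column u) , a

  lab-unlab : ∀ v → lab (unlab v) ≡ v
  lab-unlab v = trans
    (cong (combine (proj₁ (remQuot {2} m v))) (proj₂ (place-column (proj₂ (remQuot {2} m v)))))
    (Finₚ.combine-remQuot {2} m v)

  pos-injective : ∀ {c c′} → place (pos c) ≡ place (pos c′) → c ≡ c′
  pos-injective {c} {c′} eq = trans (sym (column-pos c))
    (trans (cong column (place-injective (s≤s (pos≤2h c)) (s≤s (pos≤2h c′)) eq)) (column-pos c′))

  unlab-lab : ∀ x → unlab (lab x) ≡ x
  unlab-lab (c , a) = trans
    (cong (λ (a , u) → proj₁ (place-column u) , a) (Finₚ.remQuot-combine {2} a (place (pos c))))
    (cong (_, a) (pos-injective (proj₂ (place-column (place (pos c))))))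

  rootState : Fin 9 → Fin 2 → State
  rootState f s = lft (proj₁ (root f s)) , proj₂ (root f s)

  position-root : ∀ f s → position f (rootState f s) ≡ (s , 0)
  position-root f s = cong value (rooted f s)

  module Cycles (f : Fin 9) = Orbit lab unlab lab-unlab unlab-lab (succ f) (side f) (index f)
    (λ x → proj₁ (succ-next f x)) (index-succ f)
    (rootState f) (λ s → cong proj₁ (position-root f s)) (λ s → cong (clip ∘ proj₂) (position-root f s))

  complete-cell : ∀ c → Complete (cell c)
  complete-cell (lft c)        = proj₁ complete c
  complete-cell (blk k k̄ p j) = proj₁ (proj₂ complete) j
  complete-cell (rgt c)        = proj₁ (proj₂ (proj₂ complete)) c
  complete-cell inf            = proj₂ (proj₂ (proj₂ complete))

  shift-level : ∀ s k k̄ .(p : k + k̄ ≡ K) j → let c = proj₁ (shift s k k̄ p j 0F 0F) in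
                (∀ b x → shift s k k̄ p j b x ≡ (c , b)) ⊎ (∀ b x → shift s k k̄ p j b x ≡ (c , x))
  shift-level same k       k̄       p j = inj₁ λ _ _ → refl
  shift-level up   k       zero    p j = inj₂ λ _ _ → refl
  shift-level up   k       (suc k̄) p j = inj₁ λ _ _ → refl
  shift-level down zero    k̄       p j = inj₂ λ _ _ → refl
  shift-level down (suc k) k̄       p j = inj₁ λ _ _ → refl

  -- Whether `b` or `x` is the level reached depends on column and direction only. So for a wanted
  -- arc it is known beforehand which half of `Complete` supplies the factor.
  goTo-level : ∀ d c → (∀ b x → goTo d c b x ≡ (step d c , b)) ⊎ (∀ b x → goTo d c b x ≡ (step d c , x))
  goTo-level d (lft c)        = inj₁ λ _ _ → refl
  goTo-level d (blk k k̄ p j) = shift-level (proj₁ (blockStep d j)) k k̄ p (proj₂ (blockStep d j))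
  goTo-level d (rgt c)        = inj₁ λ _ _ → refl
  goTo-level d inf            = inj₁ λ _ _ → refl

  succ-stay : ∀ c a → ∃ λ f → succ f (c , a) ≡ (c , opposite a)
  succ-stay c a with proj₁ (complete-cell c a)
  ... | f , st = f , lemma st
    where
    lemma : ∀ {mv} → IsStay mv → apply mv c a ≡ (c , opposite a)
    lemma isStay = refl

  succ-step : ∀ d c a b → ∃ λ f → succ f (c , a) ≡ (step d c , b)
  succ-step d c a b with goTo-level d c | proj₂ (complete-cell c a) d b
  ... | inj₁ eq | (f , g) , _ = f , lemma g
    where
    lemma : ∀ {mv} → Goes d b mv → apply mv c a ≡ (step d c , b)
    lemma (goes {x}) = eq b x
  ... | inj₂ eq | _ , (f , l) = f , lemma l
    where
    lemma : ∀ {mv} → Leaves d b mv → apply mv c a ≡ (step d c , b)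
    lemma (leaves {b′}) = eq b′ b

  arc-lab : ∀ f {x y} → succ f x ≡ y → Arc (Cycles.factor f) (lab x) (lab y)
  arc-lab f {x} refl = Cycles.factor-arc f x

  step-adjacent₀ : ∀ c → Adjacent 0 (place (pos c)) (place (pos (step 0F c)))
  step-adjacent₀ c with pos-step c
  ... | inj₂ refl = subst (λ z → Adjacent 0 (place z) (place 0)) size place-adjacent-last
  ... | inj₁ eq   = subst (λ z → Adjacent 0 (place (pos c)) (place z)) (sym eq)
    (place-adjacent (pos c) (subst (_≤ h + h) eq (pos≤2h (step 0F c))))

  step-adjacent₁ : ∀ c → Adjacent 1 (place (pos c)) (place (pos (step 2F c)))
  step-adjacent₁ c = leap-adjacent (pos≤2h c) (pos≤2h (step 2F c)) (leap c)

  -- A vertex has only one successor on the zigzag, by `vertex-injective`. So once the step in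
  -- direction `d` is known to follow H_i, every consecutive pair of H_i is such a step.
  adjacent-columns : ∀ {i d} → i < h → (∀ c → Adjacent i (place (pos c)) (place (pos (step d c)))) →
                     ∀ {u v} → Adjacent i u v → ∃ λ c → place (pos c) ≡ u × place (pos (step d c)) ≡ v
  adjacent-columns {i} i<h adj {u} (p , eu , ev) =
    let c , ec = place-column u
        q , qu , qv = adj c
        p≡q = vertex-injective i<h (trans eu (sym (trans qu ec)))
    in c , ec , trans (sym qv) (trans (cong (vertex i ∘ next) (sym p≡q)) ev)

  covers : ∀ {i} d d′ → i < h → (∀ c → Adjacent i (place (pos c)) (place (pos (step d c)))) →
           (∀ c → step d′ (step d c) ≡ c) →
           ∀ {u v} → Adjacent i u v ⊎ Adjacent i v u → ∀ a b →
           ∃ λ f → Arc (Cycles.factor f) (combine a u) (combine b v)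
  covers d d′ i<h adj back (inj₁ uv) a b =
    let c , eu , ev = adjacent-columns i<h adj uv
        f , eq      = succ-step d c a b
    in f , subst₂ (Arc (Cycles.factor f)) (cong (combine a) eu) (cong (combine b) ev) (arc-lab f eq)
  covers d d′ i<h adj back (inj₂ vu) a b =
    let c , ev , eu = adjacent-columns i<h adj vu
        f , eq      = succ-step d′ (step d c) a b
    in f , subst₂ (Arc (Cycles.factor f)) (cong (combine a) eu) (cong (combine b) ev)
             (arc-lab f (trans eq (cong (_, b) (back c))))

  special : Special h
  special = record
    { factors   = Cycles.factor
    ; verticals = verticals′
    ; edges     = edges′
    }
    where
    verticals′ : ∀ (a : Fin 2) (u : Fin m) → ∃ λ f → Arc (Cycles.factor f) (combine a u) (combine (opposite a) u)
    verticals′ a u =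
      let c , ec = place-column u
          f , eq = succ-stay c a
      in f , subst₂ (Arc (Cycles.factor f)) (cong (combine a) ec) (cong (combine (opposite a)) ec) (arc-lab f eq)

    edges′ : ∀ {i u v} → i < 2 → Adjacent i u v ⊎ Adjacent i v u → ∀ (a b : Fin 2) →
             ∃ λ f → Arc (Cycles.factor f) (combine a u) (combine b v)
    edges′ {zero}        _ = covers 0F 1F 0<h step-adjacent₀ back₀
    edges′ {suc zero}    _ = covers 2F 3F 2≤h step-adjacent₁ back₁
    edges′ {suc (suc i)} (s≤s (s≤s ()))

-- Tables and small cases

rightStep₄ : Dir → Fin 4 → Port 0
rightStep₄ 0F 0F = rgt 1F
rightStep₄ 0F 1F = rgt 2F
rightStep₄ 0F 2F = rgt 3F
rightStep₄ 0F 3F = inf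
rightStep₄ 1F 0F = lst 3F
rightStep₄ 1F 1F = rgt 0F
rightStep₄ 1F 2F = rgt 1F
rightStep₄ 1F 3F = rgt 2F
rightStep₄ 2F 0F = rgt 2F
rightStep₄ 2F 1F = lst 2F
rightStep₄ 2F 2F = inf
rightStep₄ 2F 3F = rgt 0F
rightStep₄ 3F 0F = rgt 3F
rightStep₄ 3F 1F = lst 0F
rightStep₄ 3F 2F = rgt 0F
rightStep₄ 3F 3F = lst 2F

rightStep₆ : Dir → Fin 6 → Port 2
rightStep₆ 0F 0F = rgt 1F
rightStep₆ 0F 1F = rgt 2F
rightStep₆ 0F 2F = rgt 3F
rightStep₆ 0F 3F = rgt 4F
rightStep₆ 0F 4F = rgt 5F
rightStep₆ 0F 5F = inf
rightStep₆ 1F 0F = lst 3F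
rightStep₆ 1F 1F = rgt 0F
rightStep₆ 1F 2F = rgt 1F
rightStep₆ 1F 3F = rgt 2F
rightStep₆ 1F 4F = rgt 3F
rightStep₆ 1F 5F = rgt 4F
rightStep₆ 2F 0F = rgt 5F
rightStep₆ 2F 1F = lst 2F
rightStep₆ 2F 2F = rgt 4F
rightStep₆ 2F 3F = rgt 0F
rightStep₆ 2F 4F = inf
rightStep₆ 2F 5F = rgt 2F
rightStep₆ 3F 0F = rgt 3F
rightStep₆ 3F 1F = lst 0F
rightStep₆ 3F 2F = rgt 5F
rightStep₆ 3F 3F = lst 2F
rightStep₆ 3F 4F = rgt 2F
rightStep₆ 3F 5F = rgt 0F

-- The slopes (β, γ) show how a cycle meets the blocks: (4, 0) and (0, 4) belong to a single passage
-- to the right or to the left, (2, 0) and (2, 4) to the outward and the return passage of a cycle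
-- that takes two vertices of each block either time. On the return the blocks have contributed 2K +
-- 2k̄ = 2k + 4k̄, up to a constant.
table₄ : Table 0
table₄ (lft 0F) 0F =
  entry (go 1F 0F 0F) 0F 0 0 0 ∷ entry (go 2F 0F 0F) 0F 0 0 0 ∷ entry (go 0F 0F 0F) 0F 0 0 0 ∷
  entry stay 0F 0 0 0 ∷ entry (go 3F 1F 1F) 0F 0 0 0 ∷ entry (go 1F 1F 1F) 0F 0 0 0 ∷
  entry (go 0F 1F 1F) 0F 0 0 0 ∷ entry (go 2F 1F 1F) 0F 0 0 0 ∷ entry (go 3F 0F 0F) 0F 0 0 0 ∷ []
table₄ (lft 0F) 1F =
  entry (go 1F 1F 1F) 1F 0 0 0 ∷ entry (go 3F 1F 1F) 0F 7 4 0 ∷ entry stay 0F 12 4 0 ∷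
  entry (go 2F 0F 0F) 0F 1 0 0 ∷ entry (go 0F 1F 1F) 1F 0 0 0 ∷ entry (go 0F 0F 0F) 1F 0 0 0 ∷
  entry (go 1F 0F 0F) 1F 0 0 0 ∷ entry (go 3F 0F 0F) 1F 0 0 0 ∷ entry (go 2F 1F 1F) 1F 0 0 0 ∷ []
table₄ (lft 1F) 0F =
  entry (go 2F 0F 0F) 1F 11 4 0 ∷ entry stay 0F 9 4 0 ∷ entry (go 0F 0F 0F) 0F 1 0 0 ∷
  entry (go 3F 0F 0F) 1F 0 0 0 ∷ entry (go 1F 0F 0F) 0F 12 4 0 ∷ entry (go 0F 1F 1F) 1F 1 0 0 ∷
  entry (go 1F 1F 1F) 1F 12 4 0 ∷ entry (go 3F 1F 1F) 1F 2 0 0 ∷ entry (go 2F 1F 1F) 1F 11 4 0 ∷ []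
table₄ (lft 1F) 1F =
  entry stay 1F 10 4 0 ∷ entry (go 3F 1F 1F) 0F 10 4 0 ∷ entry (go 1F 1F 1F) 0F 11 4 0 ∷
  entry (go 2F 0F 0F) 0F 11 4 0 ∷ entry (go 0F 0F 0F) 1F 1 0 0 ∷ entry (go 1F 0F 0F) 0F 12 4 0 ∷
  entry (go 0F 1F 1F) 0F 1 0 0 ∷ entry (go 2F 1F 1F) 0F 11 4 0 ∷ entry (go 3F 0F 0F) 0F 2 0 0 ∷ []
table₄ (lft 2F) 0F =
  entry (go 0F 1F 1F) 1F 8 4 0 ∷ entry (go 0F 0F 0F) 1F 0 0 0 ∷ entry (go 3F 1F 1F) 0F 2 0 0 ∷
  entry (go 2F 0F 0F) 0F 3 0 0 ∷ entry stay 1F 2 0 0 ∷ entry (go 1F 1F 1F) 0F 11 4 0 ∷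
  entry (go 1F 0F 0F) 1F 11 4 0 ∷ entry (go 3F 0F 0F) 1F 11 4 0 ∷ entry (go 2F 1F 1F) 1F 2 0 0 ∷ []
table₄ (lft 2F) 1F =
  entry stay 1F 7 4 0 ∷ entry (go 2F 0F 0F) 1F 2 0 0 ∷ entry (go 1F 1F 1F) 0F 10 4 0 ∷
  entry (go 1F 0F 0F) 1F 12 4 0 ∷ entry (go 3F 1F 1F) 1F 3 0 0 ∷ entry (go 0F 0F 0F) 1F 2 0 0 ∷
  entry (go 0F 1F 1F) 0F 2 0 0 ∷ entry (go 2F 1F 1F) 0F 2 0 0 ∷ entry (go 3F 0F 0F) 0F 11 4 0 ∷ []
table₄ (lft 3F) 0F =
  entry (go 2F 1F 1F) 1F 12 4 0 ∷ entry (go 1F 1F 1F) 1F 1 0 0 ∷ entry stay 1F 0 0 0 ∷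
  entry (go 2F 0F 0F) 0F 12 4 0 ∷ entry (go 0F 0F 0F) 0F 2 0 0 ∷ entry (go 0F 1F 1F) 1F 3 0 0 ∷
  entry (go 1F 0F 0F) 1F 10 4 0 ∷ entry (go 3F 0F 0F) 1F 1 0 0 ∷ entry (go 3F 1F 1F) 0F 1 0 0 ∷ []
table₄ (lft 3F) 1F =
  entry (go 3F 1F 1F) 1F 9 4 0 ∷ entry (go 3F 0F 0F) 0F 8 4 0 ∷ entry (go 0F 0F 0F) 1F 1 0 0 ∷
  entry (go 1F 1F 1F) 1F 11 4 0 ∷ entry stay 0F 1 0 0 ∷ entry (go 1F 0F 0F) 0F 10 4 0 ∷
  entry (go 0F 1F 1F) 0F 3 0 0 ∷ entry (go 2F 0F 0F) 0F 12 4 0 ∷ entry (go 2F 1F 1F) 1F 12 4 0 ∷ []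
table₄ (blk 0F) 0F =
  entry (go 0F 0F 0F) 0F 10 0 4 ∷ entry (go 0F 1F 1F) 0F 5 2 4 ∷ entry (go 3F 1F 1F) 1F 2 2 0 ∷
  entry (go 2F 0F 0F) 0F 5 4 0 ∷ entry stay 0F 3 4 0 ∷ entry (go 1F 1F 1F) 0F 9 0 4 ∷
  entry (go 1F 0F 0F) 1F 9 0 4 ∷ entry (go 3F 0F 0F) 1F 9 0 4 ∷ entry (go 2F 1F 1F) 1F 4 4 0 ∷ []
table₄ (blk 0F) 1F =
  entry stay 0F 9 0 4 ∷ entry (go 2F 0F 1F) 0F 2 2 0 ∷ entry (go 1F 0F 0F) 1F 12 2 4 ∷
  entry (go 1F 1F 1F) 1F 10 0 4 ∷ entry (go 3F 1F 1F) 0F 4 4 0 ∷ entry (go 0F 0F 0F) 1F 4 4 0 ∷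
  entry (go 0F 1F 1F) 0F 4 4 0 ∷ entry (go 2F 1F 0F) 0F 4 4 0 ∷ entry (go 3F 0F 0F) 0F 9 0 4 ∷ []
table₄ (blk 1F) 0F =
  entry stay 0F 11 0 4 ∷ entry (go 1F 1F 1F) 0F 1 2 0 ∷ entry (go 2F 1F 1F) 0F 9 2 4 ∷
  entry (go 2F 0F 0F) 0F 2 4 0 ∷ entry (go 0F 0F 0F) 1F 5 4 0 ∷ entry (go 0F 1F 1F) 1F 5 4 0 ∷
  entry (go 1F 0F 0F) 1F 8 0 4 ∷ entry (go 3F 0F 1F) 1F 12 0 4 ∷ entry (go 3F 1F 0F) 0F 12 0 4 ∷ []
table₄ (blk 1F) 1F =
  entry (go 3F 1F 0F) 0F 12 0 4 ∷ entry (go 3F 0F 1F) 0F 6 2 4 ∷ entry (go 0F 0F 0F) 0F 3 2 0 ∷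
  entry (go 1F 1F 1F) 1F 9 0 4 ∷ entry stay 1F 4 4 0 ∷ entry (go 1F 0F 0F) 0F 8 0 4 ∷
  entry (go 0F 1F 1F) 0F 5 4 0 ∷ entry (go 2F 1F 1F) 0F 1 4 0 ∷ entry (go 2F 0F 0F) 1F 1 4 0 ∷ []
table₄ (blk 2F) 0F =
  entry (go 0F 0F 0F) 1F 4 0 4 ∷ entry (go 0F 1F 1F) 1F 11 2 4 ∷ entry (go 3F 1F 0F) 0F 4 2 0 ∷
  entry (go 2F 0F 0F) 0F 7 4 0 ∷ entry stay 1F 6 4 0 ∷ entry (go 1F 1F 1F) 0F 7 0 4 ∷
  entry (go 1F 0F 0F) 1F 7 0 4 ∷ entry (go 3F 0F 1F) 1F 7 0 4 ∷ entry (go 2F 1F 1F) 1F 6 4 0 ∷ []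
table₄ (blk 2F) 1F =
  entry stay 1F 3 0 4 ∷ entry (go 2F 0F 1F) 1F 4 2 0 ∷ entry (go 1F 0F 0F) 0F 8 2 4 ∷
  entry (go 1F 1F 1F) 1F 8 0 4 ∷ entry (go 3F 1F 1F) 1F 7 4 0 ∷ entry (go 0F 0F 0F) 1F 6 4 0 ∷
  entry (go 0F 1F 1F) 0F 6 4 0 ∷ entry (go 2F 1F 0F) 0F 6 4 0 ∷ entry (go 3F 0F 0F) 0F 7 0 4 ∷ []
table₄ (blk 3F) 0F =
  entry stay 1F 5 0 4 ∷ entry (go 1F 1F 1F) 1F 3 2 0 ∷ entry (go 2F 1F 1F) 1F 11 2 4 ∷
  entry (go 2F 0F 0F) 0F 4 4 0 ∷ entry (go 0F 0F 0F) 0F 6 4 0 ∷ entry (go 0F 1F 1F) 1F 7 4 0 ∷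
  entry (go 1F 0F 0F) 1F 6 0 4 ∷ entry (go 3F 0F 0F) 1F 10 0 4 ∷ entry (go 3F 1F 1F) 0F 10 0 4 ∷ []
table₄ (blk 3F) 1F =
  entry (go 3F 1F 1F) 1F 6 0 4 ∷ entry (go 3F 0F 0F) 1F 12 2 4 ∷ entry (go 0F 0F 1F) 1F 3 2 0 ∷
  entry (go 1F 1F 1F) 1F 7 0 4 ∷ entry stay 0F 5 4 0 ∷ entry (go 1F 0F 0F) 0F 6 0 4 ∷
  entry (go 0F 1F 0F) 0F 7 4 0 ∷ entry (go 2F 1F 1F) 0F 3 4 0 ∷ entry (go 2F 0F 0F) 1F 3 4 0 ∷ []
table₄ (rgt 0F) 0F =
  entry (go 0F 0F 0F) 0F 6 0 0 ∷ entry (go 2F 0F 0F) 1F 8 2 0 ∷ entry (go 1F 0F 0F) 1F 10 2 0 ∷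
  entry stay 1F 5 0 0 ∷ entry (go 3F 1F 1F) 0F 7 4 0 ∷ entry (go 1F 1F 1F) 0F 5 0 0 ∷
  entry (go 0F 1F 1F) 0F 8 4 0 ∷ entry (go 2F 1F 1F) 0F 8 4 0 ∷ entry (go 3F 0F 0F) 0F 5 0 0 ∷ []
table₄ (rgt 0F) 1F =
  entry (go 2F 1F 1F) 0F 3 0 0 ∷ entry stay 1F 7 2 0 ∷ entry (go 3F 0F 0F) 1F 4 2 0 ∷
  entry (go 1F 1F 1F) 1F 6 0 0 ∷ entry (go 0F 0F 0F) 1F 9 4 0 ∷ entry (go 0F 1F 1F) 1F 8 4 0 ∷
  entry (go 1F 0F 0F) 1F 5 0 0 ∷ entry (go 3F 1F 1F) 1F 5 0 0 ∷ entry (go 2F 0F 0F) 1F 8 4 0 ∷ []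
table₄ (rgt 1F) 0F =
  entry stay 0F 7 0 0 ∷ entry (go 3F 0F 0F) 0F 4 2 0 ∷ entry (go 0F 0F 0F) 0F 5 2 0 ∷
  entry (go 2F 0F 0F) 0F 6 4 0 ∷ entry (go 0F 1F 1F) 1F 10 4 0 ∷ entry (go 1F 0F 0F) 0F 4 0 0 ∷
  entry (go 1F 1F 1F) 1F 4 0 0 ∷ entry (go 2F 1F 1F) 0F 5 4 0 ∷ entry (go 3F 1F 1F) 0F 8 0 0 ∷ []
table₄ (rgt 1F) 1F =
  entry (go 3F 1F 1F) 0F 8 0 0 ∷ entry stay 0F 3 2 0 ∷ entry (go 2F 1F 1F) 0F 7 2 0 ∷
  entry (go 1F 0F 0F) 1F 4 0 0 ∷ entry (go 1F 1F 1F) 1F 8 4 0 ∷ entry (go 0F 0F 0F) 1F 9 4 0 ∷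
  entry (go 0F 1F 1F) 0F 9 4 0 ∷ entry (go 3F 0F 0F) 1F 8 0 0 ∷ entry (go 2F 0F 0F) 1F 5 4 0 ∷ []
table₄ (rgt 2F) 0F =
  entry (go 3F 0F 0F) 0F 5 0 0 ∷ entry (go 0F 0F 0F) 1F 9 2 0 ∷ entry (go 1F 1F 1F) 0F 6 2 0 ∷
  entry stay 1F 2 0 0 ∷ entry (go 2F 0F 0F) 0F 10 4 0 ∷ entry (go 0F 1F 1F) 1F 10 4 0 ∷
  entry (go 1F 0F 0F) 1F 3 0 0 ∷ entry (go 3F 1F 1F) 1F 4 0 0 ∷ entry (go 2F 1F 1F) 1F 9 4 0 ∷ []
table₄ (rgt 2F) 1F =
  entry stay 0F 4 0 0 ∷ entry (go 3F 1F 1F) 1F 6 2 0 ∷ entry (go 0F 1F 1F) 1F 8 2 0 ∷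
  entry (go 1F 1F 1F) 1F 3 0 0 ∷ entry (go 2F 1F 1F) 1F 11 4 0 ∷ entry (go 1F 0F 0F) 0F 3 0 0 ∷
  entry (go 0F 0F 0F) 0F 10 4 0 ∷ entry (go 2F 0F 0F) 0F 9 4 0 ∷ entry (go 3F 0F 0F) 0F 4 0 0 ∷ []
table₄ (rgt 3F) 0F =
  entry (go 2F 1F 1F) 0F 2 0 0 ∷ entry (go 3F 0F 0F) 1F 10 2 0 ∷ entry (go 0F 0F 0F) 1F 5 2 0 ∷
  entry stay 0F 8 4 0 ∷ entry (go 1F 0F 0F) 0F 9 4 0 ∷ entry (go 1F 1F 1F) 0F 2 0 0 ∷
  entry (go 0F 1F 1F) 0F 11 4 0 ∷ entry (go 2F 0F 0F) 0F 7 4 0 ∷ entry (go 3F 1F 1F) 0F 6 0 0 ∷ []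
table₄ (rgt 3F) 1F =
  entry (go 3F 1F 1F) 1F 2 0 0 ∷ entry (go 1F 1F 1F) 1F 5 2 0 ∷ entry (go 2F 0F 0F) 1F 9 2 0 ∷
  entry (go 0F 1F 1F) 0F 9 4 0 ∷ entry stay 0F 8 4 0 ∷ entry (go 0F 0F 0F) 1F 11 4 0 ∷
  entry (go 1F 0F 0F) 1F 2 0 0 ∷ entry (go 3F 0F 0F) 1F 6 0 0 ∷ entry (go 2F 1F 1F) 1F 7 4 0 ∷ []
table₄ inf 0F =
  entry (go 1F 0F 0F) 0F 1 0 0 ∷ entry (go 0F 0F 0F) 0F 12 4 0 ∷ entry stay 1F 6 2 0 ∷
  entry (go 3F 0F 0F) 1F 1 0 0 ∷ entry (go 2F 0F 0F) 0F 11 4 0 ∷ entry (go 0F 1F 1F) 1F 12 4 0 ∷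
  entry (go 1F 1F 1F) 1F 1 0 0 ∷ entry (go 2F 1F 1F) 0F 10 4 0 ∷ entry (go 3F 1F 1F) 0F 3 0 0 ∷ []
table₄ inf 1F =
  entry (go 1F 1F 1F) 1F 1 0 0 ∷ entry stay 0F 11 4 0 ∷ entry (go 3F 1F 1F) 1F 7 2 0 ∷
  entry (go 2F 1F 1F) 0F 10 4 0 ∷ entry (go 0F 1F 1F) 1F 12 4 0 ∷ entry (go 1F 0F 0F) 0F 1 0 0 ∷
  entry (go 0F 0F 0F) 0F 12 4 0 ∷ entry (go 3F 0F 0F) 1F 3 0 0 ∷ entry (go 2F 0F 0F) 1F 10 4 0 ∷ []

root₄ : Fin 9 → Fin 2 → Fin 4 × Fin 2
root₄ 0F 0F = 0F , 0F
root₄ 0F 1F = 0F , 1F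
root₄ 1F 0F = 0F , 0F
root₄ 1F 1F = 2F , 0F
root₄ 2F 0F = 0F , 0F
root₄ 2F 1F = 3F , 0F
root₄ 3F 0F = 0F , 0F
root₄ 3F 1F = 1F , 0F
root₄ 4F 0F = 0F , 0F
root₄ 4F 1F = 0F , 1F
root₄ 5F 0F = 0F , 0F
root₄ 5F 1F = 0F , 1F
root₄ 6F 0F = 0F , 0F
root₄ 6F 1F = 0F , 1F
root₄ 7F 0F = 0F , 0F
root₄ 7F 1F = 0F , 1F
root₄ 8F 0F = 0F , 0F
root₄ 8F 1F = 0F , 1F

table₆ : Table 2
table₆ (lft 0F) 0F =
  entry (go 0F 0F 0F) 0F 0 0 0 ∷ entry (go 2F 0F 0F) 0F 0 0 0 ∷ entry (go 3F 1F 1F) 0F 0 0 0 ∷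
  entry (go 1F 0F 0F) 0F 0 0 0 ∷ entry stay 0F 0 0 0 ∷ entry (go 1F 1F 1F) 0F 0 0 0 ∷
  entry (go 0F 1F 1F) 0F 0 0 0 ∷ entry (go 2F 1F 1F) 0F 0 0 0 ∷ entry (go 3F 0F 0F) 0F 0 0 0 ∷ []
table₆ (lft 0F) 1F =
  entry (go 1F 1F 1F) 1F 0 0 0 ∷ entry stay 0F 14 4 0 ∷ entry (go 0F 1F 1F) 0F 11 4 0 ∷
  entry (go 2F 0F 0F) 1F 0 0 0 ∷ entry (go 3F 1F 1F) 0F 1 0 0 ∷ entry (go 0F 0F 0F) 1F 0 0 0 ∷
  entry (go 1F 0F 0F) 1F 0 0 0 ∷ entry (go 3F 0F 0F) 1F 0 0 0 ∷ entry (go 2F 1F 1F) 1F 0 0 0 ∷ []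
table₆ (lft 1F) 0F =
  entry (go 3F 0F 0F) 0F 1 0 0 ∷ entry stay 1F 0 0 0 ∷ entry (go 0F 0F 0F) 1F 0 0 0 ∷
  entry (go 2F 0F 0F) 0F 13 4 0 ∷ entry (go 1F 0F 0F) 0F 14 4 0 ∷ entry (go 0F 1F 1F) 1F 1 0 0 ∷
  entry (go 1F 1F 1F) 1F 14 4 0 ∷ entry (go 3F 1F 1F) 1F 2 0 0 ∷ entry (go 2F 1F 1F) 1F 13 4 0 ∷ []
table₆ (lft 1F) 1F =
  entry (go 1F 1F 1F) 1F 14 4 0 ∷ entry (go 2F 0F 0F) 1F 1 0 0 ∷ entry (go 3F 1F 1F) 0F 12 4 0 ∷
  entry stay 0F 12 4 0 ∷ entry (go 0F 0F 0F) 1F 0 0 0 ∷ entry (go 1F 0F 0F) 0F 14 4 0 ∷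
  entry (go 0F 1F 1F) 0F 1 0 0 ∷ entry (go 2F 1F 1F) 0F 13 4 0 ∷ entry (go 3F 0F 0F) 0F 2 0 0 ∷ []
table₆ (lft 2F) 0F =
  entry (go 0F 0F 0F) 1F 11 4 0 ∷ entry (go 0F 1F 1F) 1F 13 4 0 ∷ entry (go 3F 1F 1F) 1F 1 0 0 ∷
  entry (go 2F 0F 0F) 1F 2 0 0 ∷ entry stay 1F 1 0 0 ∷ entry (go 1F 1F 1F) 0F 13 4 0 ∷
  entry (go 1F 0F 0F) 1F 13 4 0 ∷ entry (go 3F 0F 0F) 1F 13 4 0 ∷ entry (go 2F 1F 1F) 1F 2 0 0 ∷ []
table₆ (lft 2F) 1F =
  entry stay 1F 10 4 0 ∷ entry (go 2F 0F 0F) 1F 3 0 0 ∷ entry (go 1F 0F 0F) 1F 14 4 0 ∷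
  entry (go 1F 1F 1F) 0F 11 4 0 ∷ entry (go 3F 1F 1F) 1F 2 0 0 ∷ entry (go 0F 0F 0F) 1F 2 0 0 ∷
  entry (go 0F 1F 1F) 0F 2 0 0 ∷ entry (go 2F 1F 1F) 0F 2 0 0 ∷ entry (go 3F 0F 0F) 0F 13 4 0 ∷ []
table₆ (lft 3F) 0F =
  entry stay 1F 12 4 0 ∷ entry (go 1F 1F 1F) 1F 2 0 0 ∷ entry (go 2F 1F 1F) 0F 10 4 0 ∷
  entry (go 2F 0F 0F) 0F 14 4 0 ∷ entry (go 0F 0F 0F) 0F 3 0 0 ∷ entry (go 0F 1F 1F) 1F 3 0 0 ∷
  entry (go 1F 0F 0F) 1F 12 4 0 ∷ entry (go 3F 0F 0F) 1F 1 0 0 ∷ entry (go 3F 1F 1F) 0F 1 0 0 ∷ []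
table₆ (lft 3F) 1F =
  entry (go 3F 1F 1F) 1F 13 4 0 ∷ entry (go 3F 0F 0F) 1F 14 4 0 ∷ entry (go 0F 0F 0F) 0F 1 0 0 ∷
  entry (go 1F 1F 1F) 0F 10 4 0 ∷ entry stay 0F 2 0 0 ∷ entry (go 1F 0F 0F) 0F 12 4 0 ∷
  entry (go 0F 1F 1F) 0F 3 0 0 ∷ entry (go 2F 0F 0F) 0F 14 4 0 ∷ entry (go 2F 1F 1F) 1F 14 4 0 ∷ []
table₆ (blk 0F) 0F =
  entry (go 0F 0F 0F) 0F 12 0 4 ∷ entry (go 0F 1F 1F) 0F 12 2 4 ∷ entry (go 3F 1F 1F) 0F 2 2 0 ∷
  entry (go 2F 0F 0F) 1F 4 4 0 ∷ entry stay 0F 4 4 0 ∷ entry (go 1F 1F 1F) 0F 11 0 4 ∷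
  entry (go 1F 0F 0F) 1F 11 0 4 ∷ entry (go 3F 0F 0F) 1F 11 0 4 ∷ entry (go 2F 1F 1F) 1F 4 4 0 ∷ []
table₆ (blk 0F) 1F =
  entry stay 0F 11 0 4 ∷ entry (go 2F 0F 0F) 0F 2 2 0 ∷ entry (go 1F 0F 0F) 0F 9 2 4 ∷
  entry (go 1F 1F 1F) 0F 9 0 4 ∷ entry (go 3F 1F 1F) 0F 5 4 0 ∷ entry (go 0F 0F 0F) 1F 4 4 0 ∷
  entry (go 0F 1F 1F) 0F 4 4 0 ∷ entry (go 2F 1F 1F) 0F 4 4 0 ∷ entry (go 3F 0F 0F) 0F 11 0 4 ∷ []
table₆ (blk 1F) 0F =
  entry stay 0F 13 0 4 ∷ entry (go 1F 1F 1F) 0F 1 2 0 ∷ entry (go 2F 1F 1F) 1F 13 2 4 ∷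
  entry (go 2F 0F 0F) 1F 1 4 0 ∷ entry (go 0F 0F 0F) 1F 4 4 0 ∷ entry (go 0F 1F 1F) 1F 5 4 0 ∷
  entry (go 1F 0F 0F) 1F 10 0 4 ∷ entry (go 3F 0F 1F) 1F 14 0 4 ∷ entry (go 3F 1F 0F) 0F 14 0 4 ∷ []
table₆ (blk 1F) 1F =
  entry (go 3F 1F 0F) 0F 14 0 4 ∷ entry (go 3F 0F 1F) 0F 13 2 4 ∷ entry (go 0F 0F 0F) 1F 2 2 0 ∷
  entry (go 1F 1F 1F) 0F 8 0 4 ∷ entry stay 1F 3 4 0 ∷ entry (go 1F 0F 0F) 0F 10 0 4 ∷
  entry (go 0F 1F 1F) 0F 5 4 0 ∷ entry (go 2F 1F 1F) 0F 1 4 0 ∷ entry (go 2F 0F 0F) 1F 1 4 0 ∷ []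
table₆ (blk 2F) 0F =
  entry (go 0F 0F 0F) 1F 7 0 4 ∷ entry (go 0F 1F 1F) 1F 11 2 4 ∷ entry (go 3F 1F 1F) 1F 3 2 0 ∷
  entry (go 2F 0F 1F) 1F 6 4 0 ∷ entry stay 1F 5 4 0 ∷ entry (go 1F 1F 1F) 0F 9 0 4 ∷
  entry (go 1F 0F 0F) 1F 9 0 4 ∷ entry (go 3F 0F 0F) 1F 9 0 4 ∷ entry (go 2F 1F 0F) 1F 6 4 0 ∷ []
table₆ (blk 2F) 1F =
  entry stay 1F 6 0 4 ∷ entry (go 2F 0F 1F) 1F 5 2 0 ∷ entry (go 1F 0F 0F) 1F 12 2 4 ∷
  entry (go 1F 1F 1F) 0F 7 0 4 ∷ entry (go 3F 1F 1F) 1F 6 4 0 ∷ entry (go 0F 0F 0F) 1F 6 4 0 ∷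
  entry (go 0F 1F 1F) 0F 6 4 0 ∷ entry (go 2F 1F 0F) 0F 6 4 0 ∷ entry (go 3F 0F 0F) 0F 9 0 4 ∷ []
table₆ (blk 3F) 0F =
  entry stay 1F 8 0 4 ∷ entry (go 1F 1F 1F) 1F 4 2 0 ∷ entry (go 2F 1F 1F) 0F 8 2 4 ∷
  entry (go 2F 0F 0F) 1F 3 4 0 ∷ entry (go 0F 0F 0F) 0F 7 4 0 ∷ entry (go 0F 1F 1F) 1F 7 4 0 ∷
  entry (go 1F 0F 0F) 1F 8 0 4 ∷ entry (go 3F 0F 0F) 1F 12 0 4 ∷ entry (go 3F 1F 1F) 0F 12 0 4 ∷ []
table₆ (blk 3F) 1F =
  entry (go 3F 1F 1F) 1F 9 0 4 ∷ entry (go 3F 0F 0F) 1F 12 2 4 ∷ entry (go 0F 0F 0F) 0F 3 2 0 ∷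
  entry (go 1F 1F 1F) 0F 6 0 4 ∷ entry stay 0F 6 4 0 ∷ entry (go 1F 0F 0F) 0F 8 0 4 ∷
  entry (go 0F 1F 1F) 0F 7 4 0 ∷ entry (go 2F 1F 1F) 0F 3 4 0 ∷ entry (go 2F 0F 0F) 1F 3 4 0 ∷ []
table₆ (rgt 0F) 0F =
  entry (go 0F 0F 0F) 0F 8 0 0 ∷ entry (go 0F 1F 1F) 0F 10 2 0 ∷ entry (go 3F 0F 0F) 0F 4 2 0 ∷
  entry (go 2F 1F 1F) 1F 8 4 0 ∷ entry stay 0F 8 4 0 ∷ entry (go 1F 1F 1F) 0F 7 0 0 ∷
  entry (go 1F 0F 0F) 1F 7 0 0 ∷ entry (go 3F 1F 1F) 1F 7 0 0 ∷ entry (go 2F 0F 0F) 1F 8 4 0 ∷ []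
table₆ (rgt 0F) 1F =
  entry stay 0F 7 0 0 ∷ entry (go 2F 0F 0F) 0F 4 2 0 ∷ entry (go 1F 0F 0F) 0F 7 2 0 ∷
  entry (go 1F 1F 1F) 0F 5 0 0 ∷ entry (go 3F 0F 0F) 0F 9 4 0 ∷ entry (go 0F 0F 0F) 1F 8 4 0 ∷
  entry (go 0F 1F 1F) 0F 8 4 0 ∷ entry (go 2F 1F 1F) 0F 8 4 0 ∷ entry (go 3F 1F 1F) 0F 7 0 0 ∷ []
table₆ (rgt 1F) 0F =
  entry stay 0F 9 0 0 ∷ entry (go 1F 1F 1F) 0F 3 2 0 ∷ entry (go 2F 1F 1F) 1F 11 2 0 ∷
  entry (go 2F 0F 0F) 1F 5 4 0 ∷ entry (go 0F 0F 0F) 1F 8 4 0 ∷ entry (go 0F 1F 1F) 1F 9 4 0 ∷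
  entry (go 1F 0F 0F) 1F 6 0 0 ∷ entry (go 3F 0F 0F) 1F 10 0 0 ∷ entry (go 3F 1F 1F) 0F 10 0 0 ∷ []
table₆ (rgt 1F) 1F =
  entry (go 3F 1F 1F) 0F 10 0 0 ∷ entry (go 3F 0F 0F) 0F 11 2 0 ∷ entry (go 0F 0F 0F) 1F 4 2 0 ∷
  entry (go 1F 1F 1F) 0F 4 0 0 ∷ entry stay 1F 7 4 0 ∷ entry (go 1F 0F 0F) 0F 6 0 0 ∷
  entry (go 0F 1F 1F) 0F 9 4 0 ∷ entry (go 2F 1F 1F) 0F 5 4 0 ∷ entry (go 2F 0F 0F) 1F 5 4 0 ∷ []
table₆ (rgt 2F) 0F =
  entry stay 0F 4 0 0 ∷ entry (go 2F 1F 1F) 1F 8 2 0 ∷ entry (go 3F 1F 1F) 1F 5 2 0 ∷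
  entry (go 0F 0F 0F) 1F 10 4 0 ∷ entry (go 0F 1F 1F) 1F 9 4 0 ∷ entry (go 1F 1F 1F) 0F 5 0 0 ∷
  entry (go 1F 0F 0F) 1F 5 0 0 ∷ entry (go 3F 0F 0F) 1F 5 0 0 ∷ entry (go 2F 0F 0F) 1F 10 4 0 ∷ []
table₆ (rgt 2F) 1F =
  entry (go 3F 0F 0F) 0F 5 0 0 ∷ entry stay 1F 7 2 0 ∷ entry (go 1F 0F 0F) 1F 10 2 0 ∷
  entry (go 1F 1F 1F) 0F 3 0 0 ∷ entry (go 2F 1F 1F) 0F 11 4 0 ∷ entry (go 0F 0F 0F) 1F 10 4 0 ∷
  entry (go 0F 1F 1F) 0F 10 4 0 ∷ entry (go 2F 0F 0F) 0F 10 4 0 ∷ entry (go 3F 1F 1F) 0F 5 0 0 ∷ []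
table₆ (rgt 3F) 0F =
  entry (go 3F 1F 1F) 1F 5 0 0 ∷ entry (go 3F 0F 0F) 1F 10 2 0 ∷ entry stay 0F 5 2 0 ∷
  entry (go 0F 0F 0F) 1F 11 4 0 ∷ entry (go 1F 1F 1F) 0F 10 4 0 ∷ entry (go 0F 1F 1F) 1F 11 4 0 ∷
  entry (go 1F 0F 0F) 1F 4 0 0 ∷ entry (go 2F 1F 1F) 0F 7 4 0 ∷ entry (go 2F 0F 0F) 1F 7 4 0 ∷ []
table₆ (rgt 3F) 1F =
  entry stay 1F 4 0 0 ∷ entry (go 1F 1F 1F) 1F 6 2 0 ∷ entry (go 2F 1F 1F) 0F 6 2 0 ∷
  entry (go 2F 0F 0F) 1F 7 4 0 ∷ entry (go 0F 0F 0F) 1F 10 4 0 ∷ entry (go 1F 0F 0F) 0F 4 0 0 ∷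
  entry (go 0F 1F 1F) 0F 11 4 0 ∷ entry (go 3F 0F 0F) 1F 8 0 0 ∷ entry (go 3F 1F 1F) 0F 8 0 0 ∷ []
table₆ (rgt 4F) 0F =
  entry (go 3F 0F 0F) 0F 3 0 0 ∷ entry (go 0F 1F 1F) 0F 8 2 0 ∷ entry (go 3F 1F 1F) 1F 9 2 0 ∷
  entry stay 1F 12 4 0 ∷ entry (go 0F 0F 0F) 1F 11 4 0 ∷ entry (go 1F 1F 1F) 0F 3 0 0 ∷
  entry (go 1F 0F 0F) 1F 3 0 0 ∷ entry (go 2F 0F 0F) 0F 11 4 0 ∷ entry (go 2F 1F 1F) 1F 11 4 0 ∷ []
table₆ (rgt 4F) 1F =
  entry (go 1F 1F 1F) 1F 3 0 0 ∷ entry (go 1F 0F 0F) 1F 9 2 0 ∷ entry stay 1F 8 2 0 ∷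
  entry (go 2F 1F 1F) 1F 13 4 0 ∷ entry (go 2F 0F 0F) 0F 12 4 0 ∷ entry (go 0F 1F 1F) 1F 12 4 0 ∷
  entry (go 0F 0F 0F) 0F 12 4 0 ∷ entry (go 3F 0F 0F) 1F 4 0 0 ∷ entry (go 3F 1F 1F) 0F 4 0 0 ∷ []
table₆ (rgt 5F) 0F =
  entry (go 3F 1F 1F) 0F 6 0 0 ∷ entry (go 0F 0F 0F) 0F 5 2 0 ∷ entry (go 1F 1F 1F) 1F 7 2 0 ∷
  entry (go 2F 1F 1F) 0F 2 0 0 ∷ entry stay 1F 12 4 0 ∷ entry (go 1F 0F 0F) 0F 2 0 0 ∷
  entry (go 0F 1F 1F) 0F 13 4 0 ∷ entry (go 3F 0F 0F) 1F 6 0 0 ∷ entry (go 2F 0F 0F) 1F 9 4 0 ∷ []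
table₆ (rgt 5F) 1F =
  entry (go 1F 1F 1F) 1F 2 0 0 ∷ entry (go 3F 0F 0F) 0F 9 2 0 ∷ entry stay 1F 6 2 0 ∷
  entry (go 2F 0F 0F) 1F 9 4 0 ∷ entry (go 0F 1F 1F) 1F 13 4 0 ∷ entry (go 0F 0F 0F) 1F 13 4 0 ∷
  entry (go 1F 0F 0F) 1F 2 0 0 ∷ entry (go 2F 1F 1F) 0F 9 4 0 ∷ entry (go 3F 1F 1F) 0F 6 0 0 ∷ []
table₆ inf 0F =
  entry (go 3F 0F 0F) 0F 2 0 0 ∷ entry stay 0F 6 2 0 ∷ entry (go 0F 0F 0F) 0F 14 4 0 ∷
  entry (go 1F 0F 0F) 0F 1 0 0 ∷ entry (go 2F 0F 0F) 0F 13 4 0 ∷ entry (go 0F 1F 1F) 1F 14 4 0 ∷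
  entry (go 1F 1F 1F) 1F 1 0 0 ∷ entry (go 2F 1F 1F) 0F 12 4 0 ∷ entry (go 3F 1F 1F) 0F 3 0 0 ∷ []
table₆ inf 1F =
  entry (go 1F 1F 1F) 1F 1 0 0 ∷ entry (go 3F 0F 0F) 0F 7 2 0 ∷ entry stay 0F 13 4 0 ∷
  entry (go 0F 1F 1F) 1F 14 4 0 ∷ entry (go 2F 1F 1F) 1F 14 4 0 ∷ entry (go 1F 0F 0F) 0F 1 0 0 ∷
  entry (go 0F 0F 0F) 0F 14 4 0 ∷ entry (go 3F 1F 1F) 1F 3 0 0 ∷ entry (go 2F 0F 0F) 1F 12 4 0 ∷ []

root₆ : Fin 9 → Fin 2 → Fin 4 × Fin 2
root₆ 0F 0F = 0F , 0F
root₆ 0F 1F = 0F , 1F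
root₆ 1F 0F = 0F , 0F
root₆ 1F 1F = 1F , 0F
root₆ 2F 0F = 0F , 0F
root₆ 2F 1F = 1F , 0F
root₆ 3F 0F = 0F , 0F
root₆ 3F 1F = 0F , 1F
root₆ 4F 0F = 0F , 0F
root₆ 4F 1F = 1F , 1F
root₆ 5F 0F = 0F , 0F
root₆ 5F 1F = 0F , 1F
root₆ 6F 0F = 0F , 0F
root₆ 6F 1F = 0F , 1F
root₆ 7F 0F = 0F , 0F
root₆ 7F 1F = 0F , 1F
root₆ 8F 0F = 0F , 0F
root₆ 8F 1F = 0F , 1F

shape₄ : Shape 0
shape₄ = record
  { rightStep = rightStep₄
  ; next-rgt  = λ { 0F → refl ; 1F → refl ; 2F → refl }
  ; last-rgt  = refl
  }

shape₆ : Shape 2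
shape₆ = record
  { rightStep = rightStep₆
  ; next-rgt  = λ { 0F → refl ; 1F → refl ; 2F → refl ; 3F → refl ; 4F → refl }
  ; last-rgt  = refl
  }

abstract
  correct₄ : Certificate.Correct shape₄ table₄
  correct₄ = from-yes (Certificate.correct? shape₄ table₄)

  complete₄ : Certificate.AllComplete shape₄ table₄
  complete₄ = from-yes (Certificate.allComplete? shape₄ table₄)

  rooted₄ : Certificate.Rooted shape₄ table₄ root₄
  rooted₄ = from-yes (Certificate.rooted? shape₄ table₄ root₄)

  correct₆ : Certificate.Correct shape₆ table₆
  correct₆ = from-yes (Certificate.correct? shape₆ table₆)

  complete₆ : Certificate.AllComplete shape₆ table₆
  complete₆ = from-yes (Certificate.allComplete? shape₆ table₆)

  rooted₆ : Certificate.Rooted shape₆ table₆ root₆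
  rooted₆ = from-yes (Certificate.rooted? shape₆ table₆ root₆)

-- The steps on the strip agree with H₀ and H₁

module Inverses {e : ℕ} (shape : Shape e) (K : ℕ)
  (rgt₀ : Shape.rightStep shape 1F (0F ↑ˡ e) ≡ lst 3F) (rgt₁ : Shape.rightStep shape 3F (1F ↑ˡ e) ≡ lst 0F)
  (rgt₃ : Shape.rightStep shape 3F (3F ↑ˡ e) ≡ lst 2F)
  (rgt-back₀ : ∀ c → Columns.step shape K 1F (Columns.step shape K 0F (Columns.rgt c)) ≡ Columns.rgt c)
  (rgt-back₁ : ∀ c → Columns.step shape K 3F (Columns.step shape K 2F (Columns.rgt c)) ≡ Columns.rgt c)
  where

  open Columns shape K

  back₀ : ∀ c → step 1F (step 0F c) ≡ c
  back₀ (lft 0F)               = refl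
  back₀ (lft 1F)               = refl
  back₀ (lft 2F)               = refl
  back₀ (lft 3F)               = refl
  back₀ (blk k k̄ p 0F)       = refl
  back₀ (blk k k̄ p 1F)       = refl
  back₀ (blk k k̄ p 2F)       = refl
  back₀ (blk k zero p 3F)      = trans (cong ⟦_⟧ rgt₀) (sym (⟦lst⟧ k p 3F))
  back₀ (blk k (suc k̄) p 3F) = refl
  back₀ (rgt c)                = rgt-back₀ c
  back₀ inf                    = refl

  back₁ : ∀ c → step 3F (step 2F c) ≡ c
  back₁ (lft 0F)               = refl
  back₁ (lft 1F)               = refl
  back₁ (lft 2F)               = refl
  back₁ (lft 3F)               = refl
  back₁ (blk k zero p 0F)      = trans (cong ⟦_⟧ rgt₁) (sym (⟦lst⟧ k p 0F))
  back₁ (blk k (suc k̄) p 0F) = refl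
  back₁ (blk zero k̄ p 1F)    = sym (⟦fst⟧ k̄ p 1F)
  back₁ (blk (suc k) k̄ p 1F) = refl
  back₁ (blk k zero p 2F)      = trans (cong ⟦_⟧ rgt₃) (sym (⟦lst⟧ k p 2F))
  back₁ (blk k (suc k̄) p 2F) = refl
  back₁ (blk k k̄ p 3F)       = refl
  back₁ (rgt c)                = rgt-back₁ c
  back₁ inf                    = refl

module Leaps {e : ℕ} (shape : Shape e) (K h : ℕ) (2≤h : 2 ≤ h) (size : h + h ≡ Columns.pos shape K Columns.inf)
  (rgt-leap : ∀ c → Places.Leap h 2≤h (Columns.pos shape K (Columns.rgt c))
                      (Columns.pos shape K (Columns.step shape K 2F (Columns.rgt c))))
  where

  open Columns shape K
  open Places h 2≤h

  up′ : ∀ k {p q} → k + k ≡ p → suc (suc (suc k) + suc (suc k)) ≡ q → Leap p q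
  up′ k refl refl = up k

  down′ : ∀ j {p q} → suc (suc j + suc j) ≡ p → j + j ≡ q → Leap p q
  down′ j refl refl = down j

  block₀ : ∀ k → 2 + (k + k) + (2 + (k + k)) ≡ 4 + (k * 4 + 0)
  block₀ = solve-∀

  block₁ : ∀ k → suc (4 + (k + k) + (4 + (k + k))) ≡ 4 + (suc k * 4 + 1)
  block₁ = solve-∀

  block₂ : ∀ k → 3 + (k + k) + (3 + (k + k)) ≡ 4 + (k * 4 + 2)
  block₂ = solve-∀

  block₃ : ∀ k → suc (5 + (k + k) + (5 + (k + k))) ≡ 4 + (suc k * 4 + 3)
  block₃ = solve-∀

  block₃′ : ∀ k → suc (3 + (k + k) + (3 + (k + k))) ≡ 4 + (k * 4 + 3)
  block₃′ = solve-∀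

  leap : ∀ c → Leap (pos c) (pos (step 2F c))
  leap (lft 0F)               = up 0
  leap (lft 1F)               = first
  leap (lft 2F)               = up 1
  leap (lft 3F)               = down 0
  leap (blk k zero p 0F)      = up′ (2 + (k + k)) (block₀ k) (trans (block₁ k) (pos-last k 1 p))
  leap (blk k (suc k̄) p 0F) = up′ (2 + (k + k)) (block₀ k) (block₁ k)
  leap (blk zero k̄ p 1F)    = down 1
  leap (blk (suc k) k̄ p 1F) = down′ (3 + (k + k)) (block₁ k) (block₂ k)
  leap (blk k zero p 2F)      = up′ (3 + (k + k)) (block₂ k) (trans (block₃ k) (pos-last k 3 p))
  leap (blk k (suc k̄) p 2F) = up′ (3 + (k + k)) (block₂ k) (block₃ k)
  leap (blk k k̄ p 3F)       = down′ (2 + (k + k)) (block₃′ k) (block₀ k)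
  leap (rgt c)                = rgt-leap c
  leap inf                    = subst (λ z → Leap z 1) size restart

special₄ : ∀ K → Special (6 + (K + K))
special₄ K = Realisation.special shape₄ table₄ root₄ correct₄ complete₄ rooted₄ K h 2≤h size
  (Leaps.leap shape₄ K h 2≤h size rgt-leap)
  (Inverses.back₀ shape₄ K refl refl refl rgt-back₀ rgt-back₁)
  (Inverses.back₁ shape₄ K refl refl refl rgt-back₀ rgt-back₁)
  where
  h = 6 + (K + K)
  2≤h : 2 ≤ h
  2≤h = s≤s (s≤s z≤n)
  open Columns shape₄ K
  open Places h 2≤h
  size : h + h ≡ pos inf
  size = eq K
    where
    eq : ∀ K → 6 + (K + K) + (6 + (K + K)) ≡ 4 + (suc K * 4 + 4)
    eq = solve-∀
  rgt-leap : ∀ c → Leap (pos (rgt c)) (pos (step 2F (rgt c)))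
  rgt-leap 0F = subst₂ Leap (eq K) (eq′ K) (penult (4 + (K + K)) refl)
    where
    eq : ∀ K → 4 + (K + K) + (4 + (K + K)) ≡ 4 + (suc K * 4 + 0)
    eq = solve-∀
    eq′ : ∀ K → 5 + (K + K) + (5 + (K + K)) ≡ 4 + (suc K * 4 + 2)
    eq′ = solve-∀
  rgt-leap 1F = subst₂ Leap (eq K) (eq′ K) (down (3 + (K + K)))
    where
    eq : ∀ K → suc (4 + (K + K) + (4 + (K + K))) ≡ 4 + (suc K * 4 + 1)
    eq = solve-∀
    eq′ : ∀ K → 3 + (K + K) + (3 + (K + K)) ≡ 4 + (K * 4 + 2)
    eq′ = solve-∀
  rgt-leap 2F = subst₂ Leap (eq K) size (last (5 + (K + K)) refl)
    where
    eq : ∀ K → 5 + (K + K) + (5 + (K + K)) ≡ 4 + (suc K * 4 + 2)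
    eq = solve-∀
  rgt-leap 3F = subst₂ Leap (eq K) (eq′ K) (down (4 + (K + K)))
    where
    eq : ∀ K → suc (5 + (K + K) + (5 + (K + K))) ≡ 4 + (suc K * 4 + 3)
    eq = solve-∀
    eq′ : ∀ K → 4 + (K + K) + (4 + (K + K)) ≡ 4 + (suc K * 4 + 0)
    eq′ = solve-∀
  rgt-back₀ : ∀ c → step 1F (step 0F (rgt c)) ≡ rgt c
  rgt-back₀ 0F = refl
  rgt-back₀ 1F = refl
  rgt-back₀ 2F = refl
  rgt-back₀ 3F = refl
  rgt-back₁ : ∀ c → step 3F (step 2F (rgt c)) ≡ rgt c
  rgt-back₁ 0F = refl
  rgt-back₁ 1F = refl
  rgt-back₁ 2F = refl
  rgt-back₁ 3F = refl

special₆ : ∀ K → Special (7 + (K + K))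
special₆ K = Realisation.special shape₆ table₆ root₆ correct₆ complete₆ rooted₆ K h 2≤h size
  (Leaps.leap shape₆ K h 2≤h size rgt-leap)
  (Inverses.back₀ shape₆ K refl refl refl rgt-back₀ rgt-back₁)
  (Inverses.back₁ shape₆ K refl refl refl rgt-back₀ rgt-back₁)
  where
  h = 7 + (K + K)
  2≤h : 2 ≤ h
  2≤h = s≤s (s≤s z≤n)
  open Columns shape₆ K
  open Places h 2≤h
  size : h + h ≡ pos inf
  size = eq K
    where
    eq : ∀ K → 7 + (K + K) + (7 + (K + K)) ≡ 4 + (suc K * 4 + 6)
    eq = solve-∀
  rgt-leap : ∀ c → Leap (pos (rgt c)) (pos (step 2F (rgt c)))
  rgt-leap 0F = subst₂ Leap (eq K) (eq′ K) (up (4 + (K + K)))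
    where
    eq : ∀ K → 4 + (K + K) + (4 + (K + K)) ≡ 4 + (suc K * 4 + 0)
    eq = solve-∀
    eq′ : ∀ K → suc (6 + (K + K) + (6 + (K + K))) ≡ 4 + (suc K * 4 + 5)
    eq′ = solve-∀
  rgt-leap 1F = subst₂ Leap (eq K) (eq′ K) (down (3 + (K + K)))
    where
    eq : ∀ K → suc (4 + (K + K) + (4 + (K + K))) ≡ 4 + (suc K * 4 + 1)
    eq = solve-∀
    eq′ : ∀ K → 3 + (K + K) + (3 + (K + K)) ≡ 4 + (K * 4 + 2)
    eq′ = solve-∀
  rgt-leap 2F = subst₂ Leap (eq K) (eq′ K) (penult (5 + (K + K)) refl)
    where
    eq : ∀ K → 5 + (K + K) + (5 + (K + K)) ≡ 4 + (suc K * 4 + 2)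
    eq = solve-∀
    eq′ : ∀ K → 6 + (K + K) + (6 + (K + K)) ≡ 4 + (suc K * 4 + 4)
    eq′ = solve-∀
  rgt-leap 3F = subst₂ Leap (eq K) (eq′ K) (down (4 + (K + K)))
    where
    eq : ∀ K → suc (5 + (K + K) + (5 + (K + K))) ≡ 4 + (suc K * 4 + 3)
    eq = solve-∀
    eq′ : ∀ K → 4 + (K + K) + (4 + (K + K)) ≡ 4 + (suc K * 4 + 0)
    eq′ = solve-∀
  rgt-leap 4F = subst₂ Leap (eq K) size (last (6 + (K + K)) refl)
    where
    eq : ∀ K → 6 + (K + K) + (6 + (K + K)) ≡ 4 + (suc K * 4 + 4)
    eq = solve-∀
  rgt-leap 5F = subst₂ Leap (eq K) (eq′ K) (down (5 + (K + K)))
    where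
    eq : ∀ K → suc (6 + (K + K) + (6 + (K + K))) ≡ 4 + (suc K * 4 + 5)
    eq = solve-∀
    eq′ : ∀ K → 5 + (K + K) + (5 + (K + K)) ≡ 4 + (suc K * 4 + 2)
    eq′ = solve-∀
  rgt-back₀ : ∀ c → step 1F (step 0F (rgt c)) ≡ rgt c
  rgt-back₀ 0F = refl
  rgt-back₀ 1F = refl
  rgt-back₀ 2F = refl
  rgt-back₀ 3F = refl
  rgt-back₀ 4F = refl
  rgt-back₀ 5F = refl
  rgt-back₁ : ∀ c → step 3F (step 2F (rgt c)) ≡ rgt c
  rgt-back₁ 0F = refl
  rgt-back₁ 1F = refl
  rgt-back₁ 2F = refl
  rgt-back₁ 3F = refl
  rgt-back₁ 4F = refl
  rgt-back₁ 5F = refl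

-- The vertex labelled u on level a is coded as am + u.
cycles₂ : Vec (Vec (Vec ℕ 5) 2) 9
cycles₂ =
  -- The nine factors form three orbits under the permutation (0 1 2)(3 4 5)(6 7 8), which fixes 9.
  ((0 ∷ 1 ∷ 4 ∷ 2 ∷ 3 ∷ []) ∷ (5 ∷ 6 ∷ 8 ∷ 9 ∷ 7 ∷ []) ∷ []) ∷
  ((1 ∷ 2 ∷ 5 ∷ 0 ∷ 4 ∷ []) ∷ (3 ∷ 7 ∷ 6 ∷ 9 ∷ 8 ∷ []) ∷ []) ∷
  ((2 ∷ 0 ∷ 3 ∷ 1 ∷ 5 ∷ []) ∷ (4 ∷ 8 ∷ 7 ∷ 9 ∷ 6 ∷ []) ∷ []) ∷
  ((0 ∷ 6 ∷ 3 ∷ 5 ∷ 1 ∷ []) ∷ (2 ∷ 9 ∷ 4 ∷ 7 ∷ 8 ∷ []) ∷ []) ∷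
  ((1 ∷ 7 ∷ 4 ∷ 3 ∷ 2 ∷ []) ∷ (0 ∷ 9 ∷ 5 ∷ 8 ∷ 6 ∷ []) ∷ []) ∷
  ((2 ∷ 8 ∷ 5 ∷ 4 ∷ 0 ∷ []) ∷ (1 ∷ 9 ∷ 3 ∷ 6 ∷ 7 ∷ []) ∷ []) ∷
  ((0 ∷ 5 ∷ 9 ∷ 1 ∷ 8 ∷ []) ∷ (2 ∷ 7 ∷ 3 ∷ 4 ∷ 6 ∷ []) ∷ []) ∷
  ((1 ∷ 3 ∷ 9 ∷ 2 ∷ 6 ∷ []) ∷ (0 ∷ 8 ∷ 4 ∷ 5 ∷ 7 ∷ []) ∷ []) ∷
  ((2 ∷ 4 ∷ 9 ∷ 0 ∷ 7 ∷ []) ∷ (1 ∷ 6 ∷ 5 ∷ 3 ∷ 8 ∷ []) ∷ []) ∷ []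

cycles₃ : Vec (Vec (Vec ℕ 7) 2) 9
cycles₃ =
  ((0 ∷ 7 ∷ 13 ∷ 8 ∷ 1 ∷ 5 ∷ 2 ∷ []) ∷ (9 ∷ 12 ∷ 4 ∷ 10 ∷ 3 ∷ 6 ∷ 11 ∷ []) ∷ []) ∷
  ((0 ∷ 1 ∷ 6 ∷ 13 ∷ 3 ∷ 10 ∷ 7 ∷ []) ∷ (8 ∷ 2 ∷ 9 ∷ 4 ∷ 11 ∷ 5 ∷ 12 ∷ []) ∷ []) ∷
  ((0 ∷ 3 ∷ 11 ∷ 4 ∷ 13 ∷ 10 ∷ 6 ∷ []) ∷ (7 ∷ 1 ∷ 12 ∷ 9 ∷ 2 ∷ 5 ∷ 8 ∷ []) ∷ []) ∷
  ((0 ∷ 13 ∷ 6 ∷ 7 ∷ 9 ∷ 1 ∷ 8 ∷ []) ∷ (2 ∷ 4 ∷ 3 ∷ 12 ∷ 5 ∷ 10 ∷ 11 ∷ []) ∷ []) ∷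
  ((0 ∷ 8 ∷ 5 ∷ 9 ∷ 11 ∷ 3 ∷ 13 ∷ []) ∷ (7 ∷ 6 ∷ 10 ∷ 4 ∷ 2 ∷ 12 ∷ 1 ∷ []) ∷ []) ∷
  ((0 ∷ 6 ∷ 3 ∷ 4 ∷ 9 ∷ 5 ∷ 1 ∷ []) ∷ (7 ∷ 8 ∷ 12 ∷ 2 ∷ 11 ∷ 10 ∷ 13 ∷ []) ∷ []) ∷
  ((0 ∷ 9 ∷ 8 ∷ 6 ∷ 4 ∷ 12 ∷ 10 ∷ []) ∷ (7 ∷ 3 ∷ 5 ∷ 11 ∷ 13 ∷ 1 ∷ 2 ∷ []) ∷ []) ∷
  ((0 ∷ 10 ∷ 12 ∷ 11 ∷ 6 ∷ 8 ∷ 9 ∷ []) ∷ (7 ∷ 2 ∷ 1 ∷ 13 ∷ 4 ∷ 5 ∷ 3 ∷ []) ∷ []) ∷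
  ((0 ∷ 2 ∷ 8 ∷ 13 ∷ 11 ∷ 12 ∷ 3 ∷ []) ∷ (7 ∷ 10 ∷ 5 ∷ 4 ∷ 6 ∷ 1 ∷ 9 ∷ []) ∷ []) ∷ []

cycles₄ : Vec (Vec (Vec ℕ 9) 2) 9
cycles₄ =
  ((0 ∷ 9 ∷ 17 ∷ 10 ∷ 16 ∷ 7 ∷ 2 ∷ 11 ∷ 1 ∷ []) ∷ (3 ∷ 14 ∷ 13 ∷ 4 ∷ 8 ∷ 5 ∷ 12 ∷ 6 ∷ 15 ∷ []) ∷ []) ∷
  ((0 ∷ 1 ∷ 10 ∷ 2 ∷ 6 ∷ 14 ∷ 12 ∷ 3 ∷ 9 ∷ []) ∷ (11 ∷ 7 ∷ 16 ∷ 13 ∷ 8 ∷ 17 ∷ 4 ∷ 5 ∷ 15 ∷ []) ∷ []) ∷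
  ((0 ∷ 17 ∷ 13 ∷ 14 ∷ 5 ∷ 4 ∷ 7 ∷ 1 ∷ 8 ∷ []) ∷ (9 ∷ 11 ∷ 2 ∷ 15 ∷ 6 ∷ 3 ∷ 12 ∷ 16 ∷ 10 ∷ []) ∷ []) ∷
  ((0 ∷ 12 ∷ 15 ∷ 4 ∷ 13 ∷ 6 ∷ 11 ∷ 16 ∷ 2 ∷ []) ∷ (9 ∷ 10 ∷ 1 ∷ 7 ∷ 3 ∷ 5 ∷ 14 ∷ 17 ∷ 8 ∷ []) ∷ []) ∷
  ((0 ∷ 10 ∷ 7 ∷ 11 ∷ 6 ∷ 12 ∷ 5 ∷ 13 ∷ 17 ∷ []) ∷ (9 ∷ 8 ∷ 4 ∷ 14 ∷ 3 ∷ 15 ∷ 2 ∷ 16 ∷ 1 ∷ []) ∷ []) ∷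
  ((0 ∷ 8 ∷ 13 ∷ 5 ∷ 3 ∷ 6 ∷ 2 ∷ 7 ∷ 10 ∷ []) ∷ (9 ∷ 1 ∷ 16 ∷ 11 ∷ 15 ∷ 12 ∷ 14 ∷ 4 ∷ 17 ∷ []) ∷ []) ∷
  ((0 ∷ 11 ∷ 10 ∷ 8 ∷ 14 ∷ 6 ∷ 4 ∷ 16 ∷ 3 ∷ []) ∷ (9 ∷ 12 ∷ 7 ∷ 13 ∷ 15 ∷ 5 ∷ 17 ∷ 1 ∷ 2 ∷ []) ∷ []) ∷
  ((0 ∷ 3 ∷ 16 ∷ 4 ∷ 6 ∷ 5 ∷ 8 ∷ 10 ∷ 11 ∷ []) ∷ (9 ∷ 2 ∷ 1 ∷ 17 ∷ 14 ∷ 15 ∷ 13 ∷ 7 ∷ 12 ∷ []) ∷ []) ∷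
  ((0 ∷ 2 ∷ 10 ∷ 17 ∷ 5 ∷ 6 ∷ 13 ∷ 16 ∷ 12 ∷ []) ∷ (9 ∷ 3 ∷ 7 ∷ 4 ∷ 15 ∷ 14 ∷ 8 ∷ 1 ∷ 11 ∷ []) ∷ []) ∷ []

cycles₅ : Vec (Vec (Vec ℕ 11) 2) 9
cycles₅ =
  ((0 ∷ 1 ∷ 10 ∷ 6 ∷ 7 ∷ 18 ∷ 5 ∷ 19 ∷ 8 ∷ 3 ∷ 14 ∷ []) ∷ (11 ∷ 21 ∷ 16 ∷ 17 ∷ 15 ∷ 4 ∷ 20 ∷ 9 ∷ 2 ∷ 13 ∷ 12 ∷ []) ∷ []) ∷
  ((0 ∷ 3 ∷ 19 ∷ 5 ∷ 10 ∷ 21 ∷ 6 ∷ 16 ∷ 8 ∷ 14 ∷ 11 ∷ []) ∷ (1 ∷ 12 ∷ 2 ∷ 20 ∷ 15 ∷ 18 ∷ 7 ∷ 17 ∷ 4 ∷ 9 ∷ 13 ∷ []) ∷ []) ∷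
  ((0 ∷ 13 ∷ 8 ∷ 4 ∷ 15 ∷ 19 ∷ 2 ∷ 11 ∷ 12 ∷ 21 ∷ 10 ∷ []) ∷ (1 ∷ 9 ∷ 14 ∷ 7 ∷ 16 ∷ 5 ∷ 17 ∷ 6 ∷ 18 ∷ 3 ∷ 20 ∷ []) ∷ []) ∷
  ((0 ∷ 10 ∷ 5 ∷ 18 ∷ 14 ∷ 19 ∷ 13 ∷ 20 ∷ 12 ∷ 1 ∷ 2 ∷ []) ∷ (11 ∷ 3 ∷ 9 ∷ 15 ∷ 8 ∷ 16 ∷ 7 ∷ 4 ∷ 6 ∷ 17 ∷ 21 ∷ []) ∷ []) ∷
  ((0 ∷ 11 ∷ 13 ∷ 2 ∷ 8 ∷ 19 ∷ 4 ∷ 18 ∷ 17 ∷ 10 ∷ 1 ∷ []) ∷ (12 ∷ 9 ∷ 20 ∷ 14 ∷ 3 ∷ 7 ∷ 15 ∷ 6 ∷ 5 ∷ 16 ∷ 21 ∷ []) ∷ []) ∷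
  ((0 ∷ 21 ∷ 5 ∷ 6 ∷ 15 ∷ 7 ∷ 14 ∷ 8 ∷ 13 ∷ 9 ∷ 12 ∷ []) ∷ (11 ∷ 1 ∷ 20 ∷ 2 ∷ 19 ∷ 3 ∷ 18 ∷ 4 ∷ 17 ∷ 16 ∷ 10 ∷ []) ∷ []) ∷
  ((0 ∷ 12 ∷ 20 ∷ 13 ∷ 19 ∷ 14 ∷ 18 ∷ 15 ∷ 17 ∷ 5 ∷ 21 ∷ []) ∷ (11 ∷ 10 ∷ 16 ∷ 6 ∷ 4 ∷ 7 ∷ 3 ∷ 8 ∷ 2 ∷ 9 ∷ 1 ∷ []) ∷ []) ∷
  ((0 ∷ 14 ∷ 20 ∷ 4 ∷ 19 ∷ 16 ∷ 18 ∷ 6 ∷ 10 ∷ 12 ∷ 13 ∷ []) ∷ (11 ∷ 2 ∷ 1 ∷ 21 ∷ 17 ∷ 7 ∷ 5 ∷ 8 ∷ 15 ∷ 9 ∷ 3 ∷ []) ∷ []) ∷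
  ((0 ∷ 2 ∷ 12 ∷ 10 ∷ 17 ∷ 18 ∷ 16 ∷ 19 ∷ 15 ∷ 20 ∷ 3 ∷ []) ∷ (11 ∷ 14 ∷ 9 ∷ 4 ∷ 8 ∷ 5 ∷ 7 ∷ 6 ∷ 21 ∷ 1 ∷ 13 ∷ []) ∷ []) ∷ []

-- Verification of the listed cycles

module Explicit (h : ℕ) (cycles : Vec (Vec (Vec ℕ (suc (h + h))) 2) 9) where
  open Walecki h

  -- The numbers in the lists are below `2 * m`; the reduction only makes them elements of
  -- `Fin (2 * m)`.
  vertexAt : Fin 9 → Fin 2 → Fin m → Fin (2 * m)
  vertexAt f j i = fromℕ< (m%n<n (lookup (lookup (lookup cycles f) j) i) (2 * m))

  Joined : Fin (2 * m) → Fin (2 * m) → Set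
  Joined x y = ∃ λ f → ∃₂ λ j i → vertexAt f j i ≡ x × vertexAt f j (next i) ≡ y

  joined? : ∀ x y → Dec (Joined x y)
  joined? x y = Finₚ.any? λ f → Finₚ.any? λ j → Finₚ.any? λ i →
    (vertexAt f j i ≟ x) ×-dec (vertexAt f j (next i) ≟ y)

  Spanning : Set
  Spanning = ∀ f v → ∃₂ λ j i → vertexAt f j i ≡ v

  spanning? : Dec Spanning
  spanning? = Finₚ.all? λ f → Finₚ.all? λ v → Finₚ.any? λ j → Finₚ.any? λ i → vertexAt f j i ≟ v

  Vertical : Set
  Vertical = ∀ (a : Fin 2) (u : Fin m) → Joined (combine a u) (combine (opposite a) u)

  vertical? : Dec Vertical
  vertical? = Finₚ.all? λ a → Finₚ.all? λ u → joined? (combine a u) (combine (opposite a) u)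

  Covering : Set
  Covering = ∀ (i : Fin 2) (p : Fin m) (a b : Fin 2) →
    Joined (combine a (vertex (toℕ i) p)) (combine b (vertex (toℕ i) (next p))) ×
    Joined (combine a (vertex (toℕ i) (next p))) (combine b (vertex (toℕ i) p))

  covering? : Dec Covering
  covering? = Finₚ.all? λ i → Finₚ.all? λ p → Finₚ.all? λ a → Finₚ.all? λ b →
    joined? (combine a (vertex (toℕ i) p)) (combine b (vertex (toℕ i) (next p))) ×-dec
    joined? (combine a (vertex (toℕ i) (next p))) (combine b (vertex (toℕ i) p))

  special : Spanning → Vertical → Covering → Special h
  special spanning vertical covering = record
    { factors   = λ f → record { at = vertexAt f ; onto = spanning f }
    ; verticals = vertical
    ; edges     = λ
      { {zero}      _ (inj₁ (p , refl , refl)) a b → proj₁ (covering 0F p a b)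
      ; {zero}      _ (inj₂ (p , refl , refl)) a b → proj₂ (covering 0F p a b)
      ; {suc zero}  _ (inj₁ (p , refl , refl)) a b → proj₁ (covering 1F p a b)
      ; {suc zero}  _ (inj₂ (p , refl , refl)) a b → proj₂ (covering 1F p a b)
      ; {suc (suc _)} (s≤s (s≤s ()))
      }
    }

abstract
  explicit₂ : Special 2
  explicit₂ = Explicit.special 2 cycles₂ (from-yes (Explicit.spanning? 2 cycles₂))
    (from-yes (Explicit.vertical? 2 cycles₂)) (from-yes (Explicit.covering? 2 cycles₂))

  explicit₃ : Special 3
  explicit₃ = Explicit.special 3 cycles₃ (from-yes (Explicit.spanning? 3 cycles₃))
    (from-yes (Explicit.vertical? 3 cycles₃)) (from-yes (Explicit.covering? 3 cycles₃))

  explicit₄ : Special 4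
  explicit₄ = Explicit.special 4 cycles₄ (from-yes (Explicit.spanning? 4 cycles₄))
    (from-yes (Explicit.vertical? 4 cycles₄)) (from-yes (Explicit.covering? 4 cycles₄))

  explicit₅ : Special 5
  explicit₅ = Explicit.special 5 cycles₅ (from-yes (Explicit.spanning? 5 cycles₅))
    (from-yes (Explicit.vertical? 5 cycles₅)) (from-yes (Explicit.covering? 5 cycles₅))

-- Two ends of four columns and at least one block take up 12 positions besides that of ∞, so the
-- strips start at 2h = 12.
special-≥6 : ∀ n → Special (6 + n)
special-≥6 n with half-sound n
... | inj₁ (K , refl) = special₄ K
... | inj₂ (K , refl) = subst Special (eq K) (special₆ K)
  where
  eq : ∀ K → 7 + (K + K) ≡ 6 + suc (K + K)
  eq = solve-∀

special : ∀ g → Special (2 + g)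
special 0 = explicit₂
special 1 = explicit₃
special 2 = explicit₄
special 3 = explicit₅
special (suc (suc (suc (suc n)))) = special-≥6 n

-- All factors together

module Assembly (g : ℕ) where
  h : ℕ
  h = 2 + g

  open Walecki h

  row : Fin g → Fin 4 → Factor m
  row i = rowFactor (2 + toℕ i) (s≤s (s≤s (Finₚ.toℕ<n i)))

  factorOf : Fin 9 ⊎ Fin (g * 4) → Factor m
  factorOf (inj₁ f) = factors (special g) f
  factorOf (inj₂ z) = uncurry row (remQuot {g} 4 z)

  allFactors : Fin (9 + g * 4) → Factor m
  allFactors f = factorOf (splitAt 9 f)

  Covered : Fin (2 * m) → Fin (2 * m) → Set
  Covered x y = ∃ λ f → Arc (allFactors f) x y

  covered-special : ∀ {x y} → (∃ λ f → Arc (factors (special g) f) x y) → Covered x y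
  covered-special {x} {y} (f , arc) = f ↑ˡ (g * 4) ,
    subst (λ z → Arc (factorOf z) x y) (sym (Finₚ.splitAt-↑ˡ 9 f (g * 4))) arc

  covered-row : ∀ {x y} i → (∃ λ k → Arc (row i k) x y) → Covered x y
  covered-row {x} {y} i (k , arc) = 9 ↑ʳ combine i k ,
    subst (λ z → Arc (factorOf z) x y) (sym (Finₚ.splitAt-↑ʳ 9 (g * 4) (combine i k)))
      (subst (λ z → Arc (uncurry row z) x y) (sym (Finₚ.remQuot-combine i k)) arc)

  covered-edge : ∀ {u v} → (∃ λ i → i < h × (Adjacent i u v ⊎ Adjacent i v u)) → ∀ (a b : Fin 2) →
                 Covered (combine a u) (combine b v)
  covered-edge (zero        , _ , adj) a b = covered-special (edges (special g) (s≤s z≤n) adj a b)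
  covered-edge (suc zero    , _ , adj) a b = covered-special (edges (special g) (s≤s (s≤s z≤n)) adj a b)
  covered-edge {u} {v} (suc (suc i) , s≤s (s≤s i<g) , adj) a b = covered-row (fromℕ< i<g)
    (rowFactor-covers (s≤s (s≤s (Finₚ.toℕ<n (fromℕ< i<g))))
      (subst (λ n → Adjacent (2 + n) u v ⊎ Adjacent (2 + n) v u) (sym (Finₚ.toℕ-fromℕ< i<g)) adj) a b)

  covered : ∀ x y → x ≢ y → Covered x y
  covered x y x≢y =
    let a , u , x≡ = Finₚ.combine-surjective {2} {m} x
        b , v , y≡ = Finₚ.combine-surjective {2} {m} y
    in subst₂ Covered x≡ y≡ (pair a u b v λ eq → x≢y (trans (sym x≡) (trans eq y≡)))
    where
    pair : ∀ (a : Fin 2) (u : Fin m) (b : Fin 2) (v : Fin m) → combine a u ≢ combine b v →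
           Covered (combine a u) (combine b v)
    pair a u b v ne with u ≟ v
    ... | no u≢v   = covered-edge (adjacent u v u≢v) a b
    ... | yes refl = subst (λ z → Covered (combine a u) (combine z u))
                       (opposite≢ {a} {b} λ a≡b → ne (cong (λ z → combine z u) a≡b))
                       (covered-special (verticals (special g) a u))

  result : CmFactorization m (2 * m)
  -- Nine factors and four for each of the other h - 2 zigzags make 4h + 1 = 2m - 1, the out-degree
  -- of every vertex; so `covered` suffices.
  result = factorization (eq g) allFactors covered
    where
    eq : ∀ g → suc (9 + g * 4) ≡ 2 * suc (2 + g + (2 + g))
    eq = solve-∀

theorem3 : ∀ (m : ℕ) → 5 ≤ m → ¬ (2 ∣ m) → CmFactorization m (2 * m)
theorem3 m 5≤m 2∤m with half-sound m
... | inj₁ (k , refl) = contradiction (divides k (trans (cong (k +_) (sym (ℕₚ.+-identityʳ k))) (ℕₚ.*-comm 2 k))) 2∤m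
... | inj₂ (zero , refl) = contradiction 5≤m λ { (s≤s ()) }
... | inj₂ (suc zero , refl) = contradiction 5≤m λ { (s≤s (s≤s (s≤s ()))) }
... | inj₂ (suc (suc g) , refl) = Assembly.result g
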